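{- Let $q\in\mathbb Q_{>0}$ and $c,d\in\mathbb Z\setminus\{0\}$. Then the pattern $$x,\quad y,\quad cx+dy,\quad q\cdot\frac yx$$ is partition regular if and only if $c=d=1$.
   Context: $\mathbb N$ denotes the set of positive integers ($0\notin\mathbb N$). A pattern $f_1(x,y),\dots,f_k(x,y)$ (with the $f_i$ rational-valued functions) is called partition regular if, for every finite colouring (partition into finitely many pieces) of $\mathbb N$, the set of monochromatic $k$-tuples $(f_1(u,v),\dots,f_k(u,v))$ with $u,v\in\mathbb N$ is infinite; here a tuple is monochromatic if all its entries belong to $\mathbb N$ and lie in the same colour. -}

module Defs where

open import Data.Fin.Base using (Fin)
open import Data.Integer.Base as ℤ using (ℤ; +_)
import Data.List.Membership.Propositional as List
open import Data.Nat.Base as ℕ using (ℕ)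
open import Data.Product.Base using (∃; ∃₂; _×_)
open import Data.Rational.Base as ℚ using (ℚ)
open import Data.Rational.Literals using (fromℤ)
open import Data.Vec.Base using (Vec; []; _∷_; map)
open import Data.Vec.Relation.Unary.All using (All)
open import Level using (0ℓ)
open import Relation.Binary.PropositionalEquality.Core using (_≡_)
open import Relation.Nullary.Negation.Core using (¬_)
open import Relation.Unary using (Pred)

record ℕ⁺ : Set where
  constructor mkℕ⁺
  field
    value          : ℕ
    .{{isNonZero}} : ℕ.NonZero value

toℤ : ℕ⁺ → ℤ
toℤ n = + ℕ⁺.value n

toℚ : ℕ⁺ → ℚ
toℚ n = fromℤ (toℤ n)

-- Infinitude is literally the negation of finiteness, so an infinite
-- subset does not come with an enumeration of its elements.

Finite : {A : Set} → Pred A 0ℓ → Set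
Finite P = ∃ λ xs → ∀ {x} → P x → x List.∈ xs

Infinite : {A : Set} → Pred A 0ℓ → Set
Infinite P = ¬ Finite P

-- Some of the r classes may be empty.

Colouring : ℕ → Set
Colouring r = ℕ⁺ → Fin r

-- The entries are rational; being a positive integer is part of being
-- monochromatic.

Monochromatic : ∀ {r k} → Colouring r → Pred (Vec ℚ k) 0ℓ
Monochromatic χ t =
  ∃ λ colour → All (λ a → ∃ λ n → a ≡ toℚ n × χ n ≡ colour) t

Pattern : ℕ → Set
Pattern k = Vec (ℕ⁺ → ℕ⁺ → ℚ) k

evaluate : ∀ {k} → Pattern k → ℕ⁺ → ℕ⁺ → Vec ℚ k
evaluate fs u v = map (λ f → f u v) fs

-- The set of tuples, not of the pairs (u , v) producing them.

MonochromaticTuples : ∀ {r k} → Colouring r → Pattern k → Pred (Vec ℚ k) 0ℓ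
MonochromaticTuples χ fs t =
  (∃₂ λ u v → t ≡ evaluate fs u v) × Monochromatic χ t

PartitionRegular : ∀ {k} → Pattern k → Set
PartitionRegular fs = ∀ r (χ : Colouring r) → Infinite (MonochromaticTuples χ fs)

scaledRatio : ℚ → ℕ⁺ → ℕ⁺ → ℚ
scaledRatio q (mkℕ⁺ x) y = q ℚ.* (toℤ y ℚ./ x)

module Submission where

-- Sufficiency.  Take b₀ ∣ b₁ ∣ … growing so fast that the sum of a block of b's
-- divides every later bⱼ, even after multiplication by the denominator of q.
-- For blocks α < β < γ with sums A, B, C the choice x = q B / A, y = q C / A gives
-- x + y = q (B + C) / A and q y / x = q C / B, so it suffices that the pairs
-- (α, β), (α, γ), (α, β ∪ γ), (β, γ) get the same colour: an instance of the
-- Milliken–Taylor theorem.  By Ramsey's theorem the colour of a pair of blocks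
-- depends only on the two lengths; what remains is to find s, t, u with
-- c(s,t) = c(s,u) = c(s,t+u) = c(t,u).  Iterating Hilbert's cube lemma gives a
-- sequence with c(sᵢ,sⱼ+sₖ) = c(sᵢ,sⱼ) for i < j < k, and Ramsey's theorem for
-- pairs finds a monochromatic triangle in it.
--
-- Necessity.  Write w = c x + d y and z = q y / x.  If d ≠ 1, giving every small
-- number its own colour makes z large, so y dominates x and w / y is close to d;
-- the logarithm modulo a constant distinguishes y from w.  If d = 1 ≠ c, take
-- a large prime p and colour by the residue and the last nonzero p-adic digit.
-- If p ∤ z then p ∤ x, whereas w ≡ y makes p divide c x; if p ∣ z then w has last
-- digit c times that of x.

open import Defs

-- Finite Ramsey theory for sublists of a fixed length.

module FiniteRamsey where
  open import Data.Bool.Base using (true; false)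
  open import Data.Fin.Base using (Fin; toℕ)
  open import Data.Fin.Properties using (toℕ-injective; toℕ<n)
  open import Data.List.Base using (List; []; _∷_; length; map; filter; take)
  open import Data.List.Properties using (length-take; length-map)
  open import Data.List.Relation.Binary.Sublist.Propositional
    using (_⊆_; []; _∷_; _∷ʳ_; ⊆-refl; ⊆-trans; minimum)
  open import Data.List.Relation.Binary.Sublist.Propositional.Properties
    using (filter-⊆; take-⊆; map⁺; All-resp-⊆)
  open import Data.List.Relation.Unary.All as All using (All; []; _∷_)
  open import Data.List.Relation.Unary.All.Properties using (all-filter)
  open import Data.Nat.Base
  open import Data.Nat.Properties
  open import Data.Product.Base using (∃; ∃₂; _×_; _,_; proj₁; proj₂)
  open import Function.Base using (_∘_)
  open import Level using (0ℓ)
  open import Relation.Binary.PropositionalEquality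
  open import Relation.Nullary using (yes; no; does; ¬?)
  open import Relation.Unary using (Pred; Decidable)

  module _ {A : Set} where

    length-filter-¬ : ∀ {P : Pred A 0ℓ} (P? : Decidable P) xs →
      length xs ≡ length (filter P? xs) + length (filter (¬? ∘ P?) xs)
    length-filter-¬ P? []       = refl
    length-filter-¬ P? (x ∷ xs) with does (P? x)
    ... | true  = cong suc (length-filter-¬ P? xs)
    ... | false = trans (cong suc (length-filter-¬ P? xs)) (sym (+-suc _ _))

    pigeonhole-⊆ : ∀ r m (f : A → ℕ) xs → All (λ x → f x < r) xs → r * m < length xs →
      ∃₂ λ c ys → ys ⊆ xs × length ys ≡ m × All (λ y → f y ≡ c) ys
    pigeonhole-⊆ zero    m f (x ∷ xs) (() ∷ _) _
    pigeonhole-⊆ (suc r) m f xs bounded long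
      with m ≤? length (filter (λ x → f x ≟ r) xs)
    ... | yes m≤ =
      r , take m zs , ⊆-trans (take-⊆ m zs) (filter-⊆ _ xs) ,
      trans (length-take m zs) (m≤n⇒m⊓n≡m m≤) ,
      All-resp-⊆ (take-⊆ m zs) (all-filter (λ x → f x ≟ r) xs)
      where zs = filter (λ x → f x ≟ r) xs
    ... | no m≰ with pigeonhole-⊆ r m f ws bounded′ long′
      where
      ws = filter (λ x → ¬? (f x ≟ r)) xs
      bounded′ : All (λ x → f x < r) ws
      bounded′ = All.zipWith (λ (f<1+r , f≢r) → ≤∧≢⇒< (≤-pred f<1+r) f≢r)
        (All-resp-⊆ (filter-⊆ _ xs) bounded , all-filter (λ x → ¬? (f x ≟ r)) xs)
      long′ : r * m < length ws
      long′ = +-cancelˡ-< m _ _ (<-trans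
        (subst (m + r * m <_) (length-filter-¬ (λ x → f x ≟ r) xs) long)
        (+-monoˡ-< (length ws) (≰⇒> m≰)))
    ... | c , ys , ys⊆ws , len , mono = c , ys , ⊆-trans ys⊆ws (filter-⊆ _ xs) , len , mono

  module _ {A : Set} where

    Homogeneous : ∀ {r} → (List A → Fin r) → ℕ → List A → Set
    Homogeneous f l xs = ∃ λ c → ∀ {S} → S ⊆ xs → length S ≡ l → f S ≡ c

    homogeneous-⊆ : ∀ {r} {f : List A → Fin r} {l xs ys} →
      ys ⊆ xs → Homogeneous f l xs → Homogeneous f l ys
    homogeneous-⊆ ys⊆xs (c , hom) = c , λ S⊆ys → hom (⊆-trans S⊆ys ys⊆xs)

    -- The end-homogeneous sequences of Erdős and Rado: the colour of a sublist with l + 1 entries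
    -- depends only on its first entry, and each entry carries that colour so that the pigeonhole
    -- principle can be applied to it.
    data EndHomogeneous {r} (f : List A → Fin r) (l : ℕ) : List (A × Fin r) → Set where
      []  : EndHomogeneous f l []
      _∷_ : ∀ {x c ps} → (∀ {S} → S ⊆ map proj₁ ps → length S ≡ l → f (x ∷ S) ≡ c) →
            EndHomogeneous f l ps → EndHomogeneous f l ((x , c) ∷ ps)

    endHomogeneous-⊆ : ∀ {r} {f : List A → Fin r} {l ps qs} →
      qs ⊆ ps → EndHomogeneous f l ps → EndHomogeneous f l qs
    endHomogeneous-⊆ []             []      = []
    endHomogeneous-⊆ (_ ∷ʳ qs⊆ps)   (_ ∷ e) = endHomogeneous-⊆ qs⊆ps e
    endHomogeneous-⊆ (refl ∷ qs⊆ps) (h ∷ e) =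
      (λ S⊆ → h (⊆-trans S⊆ (map⁺ proj₁ qs⊆ps))) ∷ endHomogeneous-⊆ qs⊆ps e

    monochromatic⇒homogeneous : ∀ {r} {f : List A → Fin r} {l c ps} →
      EndHomogeneous f l ps → All (λ p → toℕ (proj₂ p) ≡ c) ps →
      ∀ {S} → S ⊆ map proj₁ ps → length S ≡ suc l → toℕ (f S) ≡ c
    monochromatic⇒homogeneous []      []       []          ()
    monochromatic⇒homogeneous (_ ∷ e) (_ ∷ cs) (_ ∷ʳ S⊆)   len = monochromatic⇒homogeneous e cs S⊆ len
    monochromatic⇒homogeneous (h ∷ e) (c ∷ cs) (refl ∷ S⊆) len =
      trans (cong toℕ (h S⊆ (suc-injective len))) c

    -- Mutual induction with `endHomogeneous`: by pigeonhole on the stored colours, a long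
    -- end-homogeneous list for `l` has many entries of one colour, and these are homogeneous for
    -- `suc l`.
    ramsey : ∀ r l m → ∃ λ N → ∀ xs → length xs ≡ N → (f : List A → Fin r) →
      ∃ λ ys → ys ⊆ xs × length ys ≡ m × Homogeneous f l ys

    -- Greedy choice: split off the first entry `x`, make the rest homogeneous for the colouring
    -- `f ∘ (x ∷_)` of sublists of length `l`, and continue inside the homogeneous part.
    endHomogeneous : ∀ r l M → ∃ λ N → ∀ xs → length xs ≡ N → (f : List A → Fin r) →
      ∃ λ ps → map proj₁ ps ⊆ xs × length ps ≡ M × EndHomogeneous f l ps
    endHomogeneous r l zero    = 0 , λ xs _ f → [] , minimum xs , refl , []
    endHomogeneous r l (suc M) = suc (proj₁ R) , step
      where
      IH = endHomogeneous r l M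
      R  = ramsey r l (proj₁ IH)
      step : ∀ xs → length xs ≡ suc (proj₁ R) → (f : List A → Fin r) →
        ∃ λ ps → map proj₁ ps ⊆ xs × length ps ≡ suc M × EndHomogeneous f l ps
      step (x ∷ xs) len f
        with ys , ys⊆xs , len′ , c , hom ← proj₂ R xs (suc-injective len) (f ∘ (x ∷_))
        with ps , ps⊆ys , len″ , e ← proj₂ IH ys len′ f
        = (x , c) ∷ ps , refl ∷ ⊆-trans ps⊆ys ys⊆xs , cong suc len″ ,
          (λ S⊆ → hom (⊆-trans S⊆ ps⊆ys)) ∷ e

    ramsey r zero    m = m , λ xs len f → xs , ⊆-refl , len , f [] , λ _ len≡0 → cong f (length≡0 len≡0)
      where
      length≡0 : ∀ {S} → length S ≡ 0 → S ≡ []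
      length≡0 {[]} _ = refl
    ramsey r (suc l) m = proj₁ E , λ xs len f → extract xs f (proj₂ E xs len f)
      where
      -- One element more than needed, so that there is a colour to return even if m = 0.
      E = endHomogeneous r l (suc (r * suc m))
      extract : ∀ xs (f : List A → Fin r) →
        (∃ λ ps → map proj₁ ps ⊆ xs × length ps ≡ suc (r * suc m) × EndHomogeneous f l ps) →
        ∃ λ ys → ys ⊆ xs × length ys ≡ m × Homogeneous f (suc l) ys
      extract xs f (ps , ps⊆xs , len , e)
        with pigeonhole-⊆ r (suc m) (toℕ ∘ proj₂) ps
               (All.universal (λ p → toℕ<n (proj₂ p)) ps) (≤-reflexive (sym len))
      ... | c , (q ∷ qs) , qs⊆ps , len′ , col ∷ cols =
        map proj₁ qs , ⊆-trans (⊆-trans (_ ∷ʳ ⊆-refl) (map⁺ proj₁ qs⊆ps)) ps⊆xs ,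
        trans (length-map proj₁ qs) (suc-injective len′) ,
        proj₂ q , λ S⊆ len″ → toℕ-injective (trans
          (monochromatic⇒homogeneous (endHomogeneous-⊆ (⊆-trans (_ ∷ʳ ⊆-refl) qs⊆ps) e) cols S⊆ len″)
          (sym col))

    module _ {T : Set} (arity : T → ℕ) where

      -- Homogeneity passes to sublists, so the colourings are treated one after the other, each
      -- inside the list left by the previous one.
      simultaneousRamsey : ∀ r m (ts : List T) → ∃ λ N →
        ∀ xs → length xs ≡ N → (f : T → List A → Fin r) →
        ∃ λ ys → ys ⊆ xs × length ys ≡ m × All (λ t → Homogeneous (f t) (arity t) ys) ts
      simultaneousRamsey r m []       = m , λ xs len f → xs , ⊆-refl , len , []
      simultaneousRamsey r m (t ∷ ts) = proj₁ R , step
        where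
        IH = simultaneousRamsey r m ts
        R  = ramsey r (arity t) (proj₁ IH)
        step : ∀ xs → length xs ≡ proj₁ R → (f : T → List A → Fin r) →
          ∃ λ ys → ys ⊆ xs × length ys ≡ m × All (λ t → Homogeneous (f t) (arity t) ys) (t ∷ ts)
        step xs len f
          with ys , ys⊆xs , len′ , hom ← proj₂ R xs len (f t)
          with zs , zs⊆ys , len″ , homs ← proj₂ IH ys len′ f
          = zs , ⊆-trans zs⊆ys ys⊆xs , len″ , homogeneous-⊆ zs⊆ys hom ∷ homs

-- Hilbert cubes, Schur-type triples and monochromatic pairs of blocks.

module ConsecutiveBlocks where
  open FiniteRamsey
  open import Data.Fin.Base as Fin using (Fin; toℕ; combine; funToFin; finToFun)
  open import Data.Fin.Properties
    using (pigeonhole; toℕ<n; finToFun-funToFin; combine-injectiveˡ; combine-injectiveʳ)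
  open import Data.List.Base using (List; []; _∷_; length; take; drop; _++_; replicate; upTo; cartesianProduct)
  open import Data.List.Properties
    using (length-take; length-drop; length-replicate; take++drop≡id; take-take; length-++; ++-assoc)
  open import Data.List.Relation.Binary.Sublist.Propositional
    using (_⊆_; []; _∷_; _∷ʳ_; ⊆-refl; ⊆-reflexive; ⊆-trans; minimum)
  open import Data.List.Relation.Binary.Sublist.Propositional.Properties
    using (take-⊆; drop-⊆; ++⁺; ++⁺ˡ; ++⁺ʳ; length-mono-≤; All-resp-⊆)
  open import Data.List.Membership.Propositional using (_∈_)
  open import Data.List.Membership.Propositional.Properties using (∈-cartesianProduct⁺; ∈-upTo⁺)
  open import Data.List.Relation.Unary.All as All using (All; []; _∷_)
  open import Data.List.Relation.Unary.All.Properties using (replicate⁺)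
  open import Data.List.Relation.Unary.AllPairs as AllPairs using (AllPairs; []; _∷_)
  open import Data.Nat.Base
  open import Data.Nat.ListAction using (sum)
  open import Data.Nat.ListAction.Properties using (sum-++)
  open import Data.Nat.Properties
  open import Data.Product.Base using (∃; _×_; _,_; proj₁; proj₂)
  open import Algebra.Properties.CommutativeSemigroup +-commutativeSemigroup using (interchange)
  open import Function.Base using (_∘_)
  open import Relation.Binary.PropositionalEquality

  Subsum : List ℕ → ℕ → Set
  Subsum xs n = ∃ λ ys → ys ⊆ xs × n ≡ sum ys

  Positive : List ℕ → Set
  Positive = All (0 <_)

  sum>0 : ∀ {xs} → Positive xs → 0 < length xs → 0 < sum xs
  sum>0 (0<x ∷ _) _ = ≤-trans 0<x (m≤m+n _ _)

  sum-⊆ : ∀ {xs ys} → xs ⊆ ys → sum xs ≤ sum ys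
  sum-⊆ []            = z≤n
  sum-⊆ (y ∷ʳ xs⊆ys)  = ≤-trans (sum-⊆ xs⊆ys) (m≤n+m _ y)
  sum-⊆ (refl ∷ xs⊆ys) = +-monoʳ-≤ _ (sum-⊆ xs⊆ys)

  subsum-+ : ∀ {xs ys m n} → Subsum xs m → Subsum ys n → Subsum (xs ++ ys) (m + n)
  subsum-+ (as , as⊆ , refl) (bs , bs⊆ , refl) = as ++ bs , ++⁺ as⊆ bs⊆ , sym (sum-++ as bs)

  subsum-⊆ : ∀ {xs ys n} → xs ⊆ ys → Subsum xs n → Subsum ys n
  subsum-⊆ xs⊆ys (zs , zs⊆xs , eq) = zs , ⊆-trans zs⊆xs xs⊆ys , eq

  take-split : ∀ {i j} (xs : List ℕ) → i ≤ j →
    sum (take j xs) ≡ sum (take i xs) + sum (drop i (take j xs))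
  take-split {i} {j} xs i≤j = begin
    sum (take j xs)                                     ≡⟨ cong sum (take++drop≡id i (take j xs)) ⟨
    sum (take i (take j xs) ++ drop i (take j xs))      ≡⟨ sum-++ (take i (take j xs)) _ ⟩
    sum (take i (take j xs)) + sum (drop i (take j xs)) ≡⟨ cong (λ zs → sum zs + sum (drop i (take j xs))) (take-take i j xs) ⟩
    sum (take (i ⊓ j) xs) + sum (drop i (take j xs))    ≡⟨ cong (λ l → sum (take l xs) + sum (drop i (take j xs))) (m≤n⇒m⊓n≡m i≤j) ⟩
    sum (take i xs) + sum (drop i (take j xs))          ∎
    where open ≡-Reasoning

  -- The points `base + n`, with `n` a subsum of `sides`, form a monochromatic Hilbert cube of
  -- dimension `m`. The fields that trace `base` and `sides` back to subsums of `xs` later bound the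
  -- numbers found.
  record Cube {k} (xs : List ℕ) (f : ℕ → Fin k) (m : ℕ) : Set where
    field
      base          : ℕ
      sides         : List ℕ
      base>0        : 0 < base
      base-subsum   : Subsum xs base
      sides-subsum  : ∀ {n} → Subsum sides n → Subsum xs n
      length-sides  : length sides ≡ m
      sides>0       : Positive sides
      invariant     : ∀ {n} → Subsum sides n → f (base + n) ≡ f base

  -- Let σ₀, ..., σₖ be the initial sums of the first `k` entries. The induction hypothesis on the
  -- remaining entries, for the product colouring n ↦ (f (σᵢ + n))ᵢ with k ^ (k + 1) colours, gives
  -- a cube each of whose translates by a σᵢ is monochromatic. Two of these k + 1 translates share
  -- their colour; the smaller shift is added to the base and the difference of the shifts becomes
  -- the new side.
  hilbertCube : ∀ k m → ∃ λ N →
    ∀ xs → length xs ≡ N → Positive xs → (f : ℕ → Fin k) → Cube xs f m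
  hilbertCube k zero = 1 , λ where
    (x ∷ []) _ (0<x ∷ []) f → record
      { base         = x
      ; sides        = []
      ; base>0       = 0<x
      ; base-subsum  = x ∷ [] , ⊆-refl , sym (+-identityʳ x)
      ; sides-subsum = subsum-⊆ (minimum _)
      ; length-sides = refl
      ; sides>0      = []
      ; invariant    = λ where ([] , [] , refl) → cong f (+-identityʳ x)
      }
  hilbertCube k (suc m) = k + proj₁ IH , step
    where
    IH = hilbertCube (k ^ suc k) m
    step : ∀ xs → length xs ≡ k + proj₁ IH → Positive xs → (f : ℕ → Fin k) → Cube xs f (suc m)
    step xs len xs>0 f = record
      { base         = sum as + C.base
      ; sides        = sum bs ∷ C.sides
      ; base>0       = ≤-trans C.base>0 (m≤n+m _ (sum as))
      ; base-subsum  = join (as , as⊆prefix , refl) C.base-subsum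
      ; sides-subsum = λ where
          (zs , _ ∷ʳ zs⊆ , eq)    → subsum-⊆ (drop-⊆ k xs) (C.sides-subsum (zs , zs⊆ , eq))
          (_ ∷ zs , refl ∷ zs⊆ , refl) →
            join (bs , ⊆-trans (drop-⊆ (toℕ i) _) (take-⊆ (toℕ j) prefix) , refl)
                 (C.sides-subsum (zs , zs⊆ , refl))
      ; length-sides = cong suc C.length-sides
      ; sides>0      = sum>0 (All-resp-⊆ bs⊆xs xs>0) bs-nonempty ∷ C.sides>0
      ; invariant    = invariant
      }
      where
      prefix = take k xs
      rest   = drop k xs

      length-prefix : length prefix ≡ k
      length-prefix = trans (length-take k xs)
        (m≤n⇒m⊓n≡m (subst (k ≤_) (sym len) (m≤m+n k _)))

      shifted : ℕ → Fin (suc k) → Fin k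
      shifted n i = f (sum (take (toℕ i) prefix) + n)

      module C = Cube (proj₂ IH rest
        (trans (length-drop k xs) (trans (cong (_∸ k) len) (m+n∸m≡n k _)))
        (All-resp-⊆ (drop-⊆ k xs) xs>0) (funToFin ∘ shifted))

      shifted-invariant : ∀ {n} → Subsum C.sides n → ∀ i → shifted (C.base + n) i ≡ shifted C.base i
      shifted-invariant {n} sub i = begin
        shifted (C.base + n) i                       ≡⟨ finToFun-funToFin (shifted (C.base + n)) i ⟨
        finToFun (funToFin (shifted (C.base + n))) i ≡⟨ cong (λ c → finToFun c i) (C.invariant sub) ⟩
        finToFun (funToFin (shifted C.base)) i       ≡⟨ finToFun-funToFin (shifted C.base) i ⟩
        shifted C.base i                             ∎
        where open ≡-Reasoning

      collision = pigeonhole (n<1+n k) (shifted C.base)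
      i     = proj₁ collision
      j     = proj₁ (proj₂ collision)
      i<j   = proj₁ (proj₂ (proj₂ collision))
      fi≡fj = proj₂ (proj₂ (proj₂ collision))
      as    = take (toℕ i) prefix
      bs    = drop (toℕ i) (take (toℕ j) prefix)

      as⊆prefix : as ⊆ prefix
      as⊆prefix = take-⊆ (toℕ i) prefix

      bs⊆xs : bs ⊆ xs
      bs⊆xs = ⊆-trans (drop-⊆ (toℕ i) _) (⊆-trans (take-⊆ (toℕ j) prefix) (take-⊆ k xs))

      bs-nonempty : 0 < length bs
      bs-nonempty = subst (0 <_)
        (sym (trans (length-drop (toℕ i) _) (cong (_∸ toℕ i)
          (trans (length-take (toℕ j) prefix)
            (m≤n⇒m⊓n≡m (subst (toℕ j ≤_) (sym length-prefix) (≤-pred (toℕ<n j))))))))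
        (m<n⇒0<n∸m i<j)

      join : ∀ {a b} → Subsum prefix a → Subsum rest b → Subsum xs (a + b)
      join p r = subst (λ zs → Subsum zs _) (take++drop≡id k xs) (subsum-+ p r)

      sum-as+bs : ∀ n → (sum as + C.base) + (sum bs + n) ≡ sum (take (toℕ j) prefix) + (C.base + n)
      sum-as+bs n = trans (interchange (sum as) C.base (sum bs) n)
        (cong (_+ (C.base + n)) (sym (take-split prefix (<⇒≤ i<j))))

      invariant : ∀ {n} → Subsum (sum bs ∷ C.sides) n → f ((sum as + C.base) + n) ≡ f (sum as + C.base)
      invariant {n} (zs , _ ∷ʳ zs⊆ , eq) =
        trans (cong f (+-assoc (sum as) C.base n)) (shifted-invariant (zs , zs⊆ , eq) i)
      invariant (_ ∷ zs , refl ∷ zs⊆ , refl) = trans (cong f (sum-as+bs (sum zs)))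
        (trans (shifted-invariant (zs , zs⊆ , refl) j) (sym fi≡fj))

  data Absorbing {r} (c : ℕ → ℕ → Fin r) : List ℕ → Set where
    []  : Absorbing c []
    _∷_ : ∀ {g ss} → AllPairs (λ s t → c g (s + t) ≡ c g s) ss → Absorbing c ss → Absorbing c (g ∷ ss)

  -- In the recursion f collects the colourings c s of the elements s chosen so far.
  absorbingSequence : ∀ r k n → ∃ λ N →
    ∀ xs → length xs ≡ N → Positive xs → (f : ℕ → Fin k) (c : ℕ → ℕ → Fin r) →
    ∃ λ ss → length ss ≡ n × All (Subsum xs) ss × Positive ss ×
      AllPairs (λ s t → f (s + t) ≡ f s) ss × Absorbing c ss
  absorbingSequence r k zero    = 0 , λ xs _ _ f c → [] , refl , [] , [] , [] , []
  absorbingSequence r k (suc n) = proj₁ H , λ xs len xs>0 f c → step xs f c (proj₂ H xs len xs>0 f)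
    where
    IH = absorbingSequence r (k * r) n
    H  = hilbertCube k (proj₁ IH)
    step : ∀ xs f (c : ℕ → ℕ → Fin r) → Cube xs f (proj₁ IH) →
      ∃ λ ss → length ss ≡ suc n × All (Subsum xs) ss × Positive ss ×
        AllPairs (λ s t → f (s + t) ≡ f s) ss × Absorbing c ss
    step xs f c C
      with ss , len , subs , ss>0 , fss , css ←
        proj₂ IH (Cube.sides C) (Cube.length-sides C) (Cube.sides>0 C)
          (λ n → combine (f n) (c (Cube.base C) n)) c
      = base ∷ ss , cong suc len , base-subsum ∷ All.map sides-subsum subs , base>0 ∷ ss>0 ,
        All.map invariant subs ∷ AllPairs.map (combine-injectiveˡ {m = k} {n = r} _ _ _ _) fss ,
        AllPairs.map (combine-injectiveʳ {m = k} {n = r} _ _ _ _) fss ∷ css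
      where open Cube C

  allPairs-pair : ∀ {R : ℕ → ℕ → Set} {xs s t} → AllPairs R xs → s ∷ t ∷ [] ⊆ xs → R s t
  allPairs-pair (_ ∷ ps) (_ ∷ʳ st⊆)   = allPairs-pair ps st⊆
  allPairs-pair (p ∷ _)  (refl ∷ t⊆)  = All.head (All-resp-⊆ t⊆ p)

  absorbing-triple : ∀ {r} {c : ℕ → ℕ → Fin r} {xs s t u} → Absorbing c xs →
    s ∷ t ∷ u ∷ [] ⊆ xs → c s (t + u) ≡ c s t
  absorbing-triple (_ ∷ as) (_ ∷ʳ stu⊆)  = absorbing-triple as stu⊆
  absorbing-triple (a ∷ _)  (refl ∷ tu⊆) = allPairs-pair a tu⊆

  record SchurTriple {r} (c : ℕ → ℕ → Fin r) (L : ℕ) : Set where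
    field
      s t u     : ℕ
      s>0       : 0 < s
      t>0       : 0 < t
      u>0       : 0 < u
      bounded   : s + (t + u) ≤ L
      su≡st     : c s u ≡ c s t
      tu≡st     : c t u ≡ c s t
      s[t+u]≡st : c s (t + u) ≡ c s t

  -- Presents a colouring of pairs as a colouring of lists, as `ramsey` expects; `c 0 0` is a
  -- default for lists with fewer than two entries.
  onFirstTwo : ∀ {C : Set} → (ℕ → ℕ → C) → List ℕ → C
  onFirstTwo c (a ∷ b ∷ _) = c a b
  onFirstTwo c _           = c 0 0

  -- All triples of an absorbing sequence satisfy c(s, t + u) = c(s, t), so a monochromatic triangle
  -- for `c` gives the other equalities. The terms are subsums of `N` ones, hence at most `N`, which
  -- makes the bound 3N independent of `c`.
  schurTriple : ∀ r → ∃ λ L → (c : ℕ → ℕ → Fin r) → SchurTriple c L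
  schurTriple r = N + (N + N) , triple
    where
    R = ramsey r 2 3
    -- One auxiliary colour: at the start no condition comes from earlier elements.
    S = absorbingSequence r 1 (proj₁ R)
    N = proj₁ S
    ones = replicate N 1

    triple : (c : ℕ → ℕ → Fin r) → SchurTriple c (N + (N + N))
    triple c
      with ss , len , subs , ss>0 , _ , absorbing ←
        proj₂ S ones (length-replicate N) (replicate⁺ N z<s) (λ _ → Fin.zero) c
      with s ∷ t ∷ u ∷ [] , stu⊆ , refl , _ , hom ← proj₂ R ss len (onFirstTwo c)
      with s>0 ∷ t>0 ∷ u>0 ∷ [] ← All-resp-⊆ stu⊆ ss>0
      with s-sub ∷ t-sub ∷ u-sub ∷ [] ← All-resp-⊆ stu⊆ subs
      = record
      { s>0 = s>0 ; t>0 = t>0 ; u>0 = u>0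
      ; bounded   = +-mono-≤ (bound s-sub) (+-mono-≤ (bound t-sub) (bound u-sub))
      ; su≡st     = trans (hom (refl ∷ t ∷ʳ refl ∷ []) refl) (sym (hom (refl ∷ refl ∷ u ∷ʳ []) refl))
      ; tu≡st     = trans (hom (s ∷ʳ refl ∷ refl ∷ []) refl) (sym (hom (refl ∷ refl ∷ u ∷ʳ []) refl))
      ; s[t+u]≡st = absorbing-triple absorbing stu⊆
      }
      where
      sum-ones : ∀ n → sum (replicate n 1) ≡ n
      sum-ones zero    = refl
      sum-ones (suc n) = cong suc (sum-ones n)

      bound : ∀ {n} → Subsum ones n → n ≤ N
      bound (_ , zs⊆ , refl) = subst (_ ≤_) (sum-ones N) (sum-⊆ zs⊆)

  module _ {A : Set} where

    -- The blocks stand in `xs` in the order γ, β, α, and the block that comes first in `xs` is the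
    -- first argument of `f`. This matches the descending list to which the record is applied.
    record MonochromaticBlocks {r} (xs : List A) (f : List A → List A → Fin r) : Set where
      field
        α β γ     : List A
        α≢[]      : 0 < length α
        β≢[]      : 0 < length β
        γ≢[]      : 0 < length γ
        blocks    : γ ++ β ++ α ⊆ xs
        αγ≡αβ     : f γ α ≡ f β α
        βγ≡αβ     : f γ β ≡ f β α
        α[βγ]≡αβ  : f (γ ++ β) α ≡ f β α

    take-++ : ∀ (xs ys : List A) → take (length xs) (xs ++ ys) ≡ xs
    take-++ []       ys = refl
    take-++ (x ∷ xs) ys = cong (x ∷_) (take-++ xs ys)

    drop-++ : ∀ (xs ys : List A) → drop (length xs) (xs ++ ys) ≡ ys
    drop-++ []       ys = refl
    drop-++ (x ∷ xs) ys = drop-++ xs ys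

    -- For lengths s and t, cutting after t entries turns `f` into a colouring of lists of length t
    -- + s. Making these colourings homogeneous at once for all s, t ≤ L leaves a colour that
    -- depends only on the two lengths, and `schurTriple` supplies the lengths of α, β, γ.
    monochromaticBlocks : ∀ r → ∃ λ N → ∀ xs → length xs ≡ N →
      (f : List A → List A → Fin r) → MonochromaticBlocks xs f
    monochromaticBlocks r = proj₁ R , λ xs len f → blocks xs f (proj₂ R xs len (split f))
      where
      L = proj₁ (schurTriple r)
      lengths = cartesianProduct (upTo (suc L)) (upTo (suc L))

      R = simultaneousRamsey (λ (s , t) → t + s) r L lengths

      split : (List A → List A → Fin r) → ℕ × ℕ → List A → Fin r
      split f (s , t) S = f (take t S) (drop t S)

      blocks : ∀ xs f → (∃ λ ys → ys ⊆ xs × length ys ≡ L ×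
        All (λ p → Homogeneous (split f p) (proj₂ p + proj₁ p) ys) lengths) → MonochromaticBlocks xs f
      blocks xs f (ys , ys⊆xs , len , hom) = record
        { α = α ; β = β ; γ = γ
        ; α≢[] = subst (0 <_) (sym |α|) s>0
        ; β≢[] = subst (0 <_) (sym |β|) t>0
        ; γ≢[] = subst (0 <_) (sym |γ|) u>0
        ; blocks = ⊆-trans (⊆-reflexive γβα) (⊆-trans (take-⊆ _ ys) ys⊆xs)
        ; αγ≡αβ = trans (colour γ α γα⊆ys) (trans (cong₂ c |α| |γ|) (trans su≡st (sym fβα)))
        ; βγ≡αβ = trans (colour γ β γβ⊆ys) (trans (cong₂ c |β| |γ|) (trans tu≡st (sym fβα)))
        ; α[βγ]≡αβ = trans (colour (γ ++ β) α (⊆-trans (⊆-reflexive (trans (++-assoc γ β α) γβα)) W⊆ys))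
            (trans (cong₂ c |α| (trans (length-++ γ) (trans (+-comm (length γ) _) (cong₂ _+_ |β| |γ|))))
              (trans s[t+u]≡st (sym fβα)))
        }
        where
        -- An initial segment of `ys` represents all sublists of its length. For t + s > L it is too
        -- short and the colour is arbitrary; `bounded` keeps the pairs of lengths in question out
        -- of that range.
        c : ℕ → ℕ → Fin r
        c s t = split f (s , t) (take (t + s) ys)
        open SchurTriple (proj₂ (schurTriple r) c)
        W = take (u + (t + s)) ys
        γ = take u W
        β = take t (drop u W)
        α = drop t (drop u W)
        γβα : γ ++ β ++ α ≡ W
        γβα = trans (cong (γ ++_) (take++drop≡id t (drop u W))) (take++drop≡id u W)
        |W| : length W ≡ u + (t + s)
        |W| = trans (length-take _ ys) (m≤n⇒m⊓n≡m (subst (u + (t + s) ≤_) (sym len)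
          (≤-trans (≤-reflexive (trans (sym (+-assoc u t s)) (trans (+-comm (u + t) s)
             (cong (s +_) (+-comm u t))))) bounded)))
        |γ| : length γ ≡ u
        |γ| = trans (length-take u W) (m≤n⇒m⊓n≡m (subst (u ≤_) (sym |W|) (m≤m+n u _)))
        |drop| : length (drop u W) ≡ t + s
        |drop| = trans (length-drop u W) (trans (cong (_∸ u) |W|) (m+n∸m≡n u _))
        |β| : length β ≡ t
        |β| = trans (length-take t (drop u W)) (m≤n⇒m⊓n≡m (subst (t ≤_) (sym |drop|) (m≤m+n t _)))
        |α| : length α ≡ s
        |α| = trans (length-drop t (drop u W)) (trans (cong (_∸ t) |drop|) (m+n∸m≡n t _))

        W⊆ys : W ⊆ ys
        W⊆ys = take-⊆ _ ys
        γβα⊆ys : γ ++ β ++ α ⊆ ys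
        γβα⊆ys = ⊆-trans (⊆-reflexive γβα) W⊆ys
        βα⊆ys : β ++ α ⊆ ys
        βα⊆ys = ⊆-trans (++⁺ˡ γ ⊆-refl) γβα⊆ys
        γα⊆ys : γ ++ α ⊆ ys
        γα⊆ys = ⊆-trans (++⁺ (⊆-refl {x = γ}) (++⁺ˡ β ⊆-refl)) γβα⊆ys
        γβ⊆ys : γ ++ β ⊆ ys
        γβ⊆ys = ⊆-trans (++⁺ (⊆-refl {x = γ}) (++⁺ʳ α ⊆-refl)) γβα⊆ys

        |S|+|T|≤ : ∀ S T → S ++ T ⊆ ys → length S + length T ≤ length ys
        |S|+|T|≤ S T S++T⊆ys = subst (_≤ length ys) (length-++ S) (length-mono-≤ S++T⊆ys)

        lengths∈ : ∀ S T → S ++ T ⊆ ys → (length T , length S) ∈ lengths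
        lengths∈ S T S++T⊆ys = ∈-cartesianProduct⁺
          (∈-upTo⁺ (s≤s (subst (length T ≤_) len (≤-trans (m≤n+m _ (length S)) (|S|+|T|≤ S T S++T⊆ys)))))
          (∈-upTo⁺ (s≤s (subst (length S ≤_) len (≤-trans (m≤m+n _ _) (|S|+|T|≤ S T S++T⊆ys)))))

        colour : ∀ S T → S ++ T ⊆ ys → f S T ≡ c (length T) (length S)
        colour S T S++T⊆ys with k , col ← All.lookup hom (lengths∈ S T S++T⊆ys) = begin
          f S T                                  ≡⟨ cong₂ f (take-++ S T) (drop-++ S T) ⟨
          split f (length T , length S) (S ++ T) ≡⟨ col S++T⊆ys (length-++ S) ⟩
          k                                      ≡⟨ col (take-⊆ _ ys) (trans (length-take _ ys)
                                                      (m≤n⇒m⊓n≡m (|S|+|T|≤ S T S++T⊆ys))) ⟨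
          c (length T) (length S)                ∎
          where open ≡-Reasoning

        fβα : f β α ≡ c s t
        fβα = trans (colour β α βα⊆ys) (cong₂ c |α| |β|)

-- Block sums dividing one another, and monochromatic x, y, x + y, z.

module DivisibleBlocks where
  open ConsecutiveBlocks
  open import Data.Fin.Base using (Fin)
  open import Data.List.Base using (List; []; _∷_; length; _++_)
  open import Data.List.Relation.Binary.Sublist.Propositional
    using (_⊆_; []; _∷_; _∷ʳ_; ⊆-refl; ⊆-trans)
  open import Data.List.Relation.Binary.Sublist.Propositional.Properties
    using (++⁺; ++⁺ˡ; ++⁺ʳ; All-resp-⊆)
  open import Data.List.Relation.Unary.All using ([]; _∷_)
  open import Data.Nat.Base
  open import Data.Nat.Divisibility
  open import Data.Nat.DivMod using (m*n/n≡m)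
  open import Data.Nat.ListAction using (sum)
  open import Data.Nat.ListAction.Properties using (sum-++)
  open import Data.Nat.Properties
  open import Data.Nat.Tactic.RingSolver using (solve-∀)
  open import Data.Product.Base using (_,_; proj₁; proj₂)
  open import Relation.Binary.PropositionalEquality

  -- In descending order, so that an earlier block of the list has the larger sum.
  growing : ℕ → ℕ → List ℕ
  growing E zero    = []
  growing E (suc n) = E * (sum (growing E n)) ! ∷ growing E n

  length-growing : ∀ E n → length (growing E n) ≡ n
  length-growing E zero    = refl
  length-growing E (suc n) = cong suc (length-growing E n)

  growing>0 : ∀ {E} → 0 < E → ∀ n → Positive (growing E n)
  growing>0 0<E zero    = []
  growing>0 0<E (suc n) = *-mono-≤ 0<E (1≤n! (sum (growing _ n))) ∷ growing>0 0<E n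

  m≤n⇒m∣n! : ∀ {m n} → 0 < m → m ≤ n → m ∣ n !
  m≤n⇒m∣n! {suc m} _ m≤n = ∣-trans (m∣m*n (m !)) (m≤n⇒m!∣n! m≤n)

  -- Every entry of β is `E` times the factorial of the sum of a list that contains α as a sublist.
  -- That sum is at least the positive number `sum α`, which therefore divides the factorial.
  growing-∣ : ∀ {E} → 0 < E → ∀ n {α} β → β ++ α ⊆ growing E n → 0 < length α →
    E * sum α ∣ sum β
  growing-∣ 0<E n       []      _             _   = _ ∣0
  growing-∣ 0<E (suc n) (b ∷ β) (_ ∷ʳ βα⊆)    α≢[] = growing-∣ 0<E n (b ∷ β) βα⊆ α≢[]
  growing-∣ {E} 0<E (suc n) {α} (_ ∷ β) (refl ∷ βα⊆) α≢[] =
    ∣m∣n⇒∣m+n (*-monoʳ-∣ E (m≤n⇒m∣n! (sum>0 (All-resp-⊆ α⊆ (growing>0 0<E n)) α≢[]) (sum-⊆ α⊆)))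
              (growing-∣ 0<E n β βα⊆ α≢[])
    where
    α⊆ : α ⊆ growing E n
    α⊆ = ⊆-trans (++⁺ˡ β ⊆-refl) βα⊆

  -- Total division, so that `pairColour` is defined for all pairs of lists, including empty ones.
  _div_ : ℕ → ℕ → ℕ
  n div zero  = 0
  n div suc k = n / suc k

  m*n-div-n : ∀ m {n} → 0 < n → (m * n) div n ≡ m
  m*n-div-n m {suc n} _ = m*n/n≡m m (suc n)

  -- Here `ratio` is z = (p / q) y / x without denominators, and the free bound `K` later produces
  -- infinitely many tuples.
  record MonochromaticQuadruple {r} (χ : ℕ → Fin r) (p q K : ℕ) : Set where
    field
      x y z   : ℕ
      x>0     : 0 < x
      y>0     : 0 < y
      z>0     : 0 < z
      K≤x     : K ≤ x
      ratio   : p * y ≡ z * (q * x)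
      χy≡χx   : χ y ≡ χ x
      χz≡χx   : χ z ≡ χ x
      χx+y≡χx : χ (x + y) ≡ χ x

  pairColour : ∀ {r} → (ℕ → Fin r) → ℕ → ℕ → List ℕ → List ℕ → Fin r
  pairColour χ p q β α = χ (p * (sum β div (q * sum α)))

  -- Let A, B, C be the sums of α, β, γ and E = q K. Divisibility gives B = k₁ E A and C = k₂ E B =
  -- k₃ E A. Then x, y, z are p / q times B / A, C / A, C / B, that is p k₁ K, p k₃ K, p k₂ K. The
  -- factor `q` of `E` clears the denominator and the factor `K` makes x at least `K`.
  blocks⇒quadruple : ∀ {r} {χ : ℕ → Fin r} {p q K} → 0 < p → 0 < q → 0 < K → ∀ N →
    MonochromaticBlocks (growing (q * K) N) (pairColour χ p q) → MonochromaticQuadruple χ p q K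
  blocks⇒quadruple {r} {χ} {p} {q} {K} p>0 q>0 K>0 N B = record
    { x = value k₁ ; y = value k₃ ; z = value k₂
    ; x>0 = value>0 k₁>0
    ; y>0 = value>0 k₃>0
    ; z>0 = value>0 k₂>0
    ; K≤x = ≤-trans (m≤n*m K k₁ {{>-nonZero k₁>0}}) (m≤n*m (k₁ * K) p {{>-nonZero p>0}})
    ; ratio = trans (cong (λ k → p * value k) k₃≡) (rearrange p q K k₁ k₂)
    ; χy≡χx = trans (sym (colour γ α k₃ α>0 γ≡)) (trans αγ≡αβ (colour β α k₁ α>0 β≡))
    ; χz≡χx = trans (sym (colour γ β k₂ β>0 γ≡′)) (trans βγ≡αβ (colour β α k₁ α>0 β≡))
    ; χx+y≡χx = trans (cong χ (sym (value-+ p K k₁ k₃)))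
        (trans (sym (colour (γ ++ β) α (k₁ + k₃) α>0 γβ≡)) (trans α[βγ]≡αβ (colour β α k₁ α>0 β≡)))
    }
    where
    open MonochromaticBlocks B

    E = q * K
    f = pairColour χ p q

    0<E : 0 < E
    0<E = *-mono-≤ q>0 K>0

    xs>0 : Positive (growing E N)
    xs>0 = growing>0 0<E N

    γα⊆ : γ ++ α ⊆ growing E N
    γα⊆ = ⊆-trans (++⁺ (⊆-refl {x = γ}) (++⁺ˡ β ⊆-refl)) blocks
    γβ⊆ : γ ++ β ⊆ growing E N
    γβ⊆ = ⊆-trans (++⁺ (⊆-refl {x = γ}) (++⁺ʳ α ⊆-refl)) blocks
    βα⊆ : β ++ α ⊆ growing E N
    βα⊆ = ⊆-trans (++⁺ˡ γ ⊆-refl) blocks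

    α>0 : 0 < sum α
    α>0 = sum>0 (All-resp-⊆ (⊆-trans (++⁺ˡ β ⊆-refl) βα⊆) xs>0) α≢[]
    β>0 : 0 < sum β
    β>0 = sum>0 (All-resp-⊆ (⊆-trans (++⁺ʳ α ⊆-refl) βα⊆) xs>0) β≢[]
    γ>0 : 0 < sum γ
    γ>0 = sum>0 (All-resp-⊆ (⊆-trans (++⁺ʳ α ⊆-refl) γα⊆) xs>0) γ≢[]

    open _∣_ (growing-∣ 0<E N β βα⊆ α≢[]) renaming (quotient to k₁; equality to β≡)
    open _∣_ (growing-∣ 0<E N γ γβ⊆ β≢[]) renaming (quotient to k₂; equality to γ≡′)
    open _∣_ (growing-∣ 0<E N γ γα⊆ α≢[]) renaming (quotient to k₃; equality to γ≡)

    quotient>0 : ∀ {m n} k → 0 < m → m ≡ k * n → 0 < k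
    quotient>0 zero    0<m refl = 0<m
    quotient>0 (suc k) _   _    = z<s

    k₁>0 = quotient>0 k₁ β>0 β≡
    k₂>0 = quotient>0 k₂ γ>0 γ≡′
    k₃>0 = quotient>0 k₃ γ>0 γ≡

    value : ℕ → ℕ
    value k = p * (k * K)

    value>0 : ∀ {k} → 0 < k → 0 < value k
    value>0 0<k = *-mono-≤ p>0 (*-mono-≤ 0<k K>0)

    γβ≡ : sum (γ ++ β) ≡ (k₁ + k₃) * (E * sum α)
    γβ≡ = trans (sum-++ γ β) (trans (+-comm (sum γ) (sum β))
      (trans (cong₂ _+_ β≡ γ≡) (sym (*-distribʳ-+ (E * sum α) k₁ k₃))))

    value-+ : ∀ p K k l → p * ((k + l) * K) ≡ p * (k * K) + p * (l * K)
    value-+ = solve-∀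

    colour : ∀ S T k → 0 < sum T → sum S ≡ k * (E * sum T) → f S T ≡ χ (value k)
    colour S T k T>0 S≡ = cong (λ n → χ (p * n)) (begin
      sum S div (q * sum T)                   ≡⟨ cong (_div (q * sum T)) (trans S≡ (assoc q K k (sum T))) ⟩
      ((k * K) * (q * sum T)) div (q * sum T) ≡⟨ m*n-div-n (k * K) (*-mono-≤ q>0 T>0) ⟩
      k * K                                   ∎)
      where
      open ≡-Reasoning
      assoc : ∀ q K k t → k * ((q * K) * t) ≡ (k * K) * (q * t)
      assoc = solve-∀

    k₃≡ : k₃ ≡ k₂ * (E * k₁)
    k₃≡ = *-cancelʳ-≡ k₃ _ (E * sum α) {{>-nonZero (*-mono-≤ 0<E α>0)}} (begin
      k₃ * (E * sum α)              ≡⟨ γ≡ ⟨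
      sum γ                         ≡⟨ γ≡′ ⟩
      k₂ * (E * sum β)              ≡⟨ cong (λ b → k₂ * (E * b)) β≡ ⟩
      k₂ * (E * (k₁ * (E * sum α))) ≡⟨ assoc E k₁ k₂ (E * sum α) ⟩
      k₂ * (E * k₁) * (E * sum α)   ∎)
      where
      open ≡-Reasoning
      assoc : ∀ E k l a → l * (E * (k * a)) ≡ l * (E * k) * a
      assoc = solve-∀

    rearrange : ∀ p q K k l →
      p * (p * (l * ((q * K) * k) * K)) ≡ p * (l * K) * (q * (p * (k * K)))
    rearrange = solve-∀

  monochromaticQuadruple : ∀ {r} (χ : ℕ → Fin r) {p q K} → 0 < p → 0 < q → 0 < K →
    MonochromaticQuadruple χ p q K
  monochromaticQuadruple {r} χ {p} {q} {K} p>0 q>0 K>0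
    with N , blocks ← monochromaticBlocks {ℕ} r =
    blocks⇒quadruple p>0 q>0 K>0 N (blocks _ (length-growing (q * K) N) (pairColour χ p q))

-- Translation between rational entries and equations in natural numbers.

module RationalEntries where
  open import Data.Integer.Base as ℤ using (+_; ∣_∣)
  import Data.Integer.Properties as ℤ
  open import Data.Nat.Base
  open import Data.Product.Base using (∃; _×_; _,_)
  open import Data.Rational.Base as ℚ using (ℚ; mkℚ; 0ℚ; ↥_; ↧ₙ_; toℚᵘ)
  open import Data.Rational.Literals using (fromℤ)
  import Data.Rational.Properties as ℚ
  open import Data.Rational.Unnormalised.Base as ℚᵘ using (mkℚᵘ; *≡*; _≃_)
  import Data.Rational.Unnormalised.Properties as ℚᵘ
  open import Function.Bundles using (_⇔_; mk⇔)
  open import Relation.Binary.PropositionalEquality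

  fromℤ-injective : ∀ {i j} → fromℤ i ≡ fromℤ j → i ≡ j
  fromℤ-injective = cong ↥_

  toℚ-injective : ∀ {m n} → toℚ m ≡ toℚ n → m ≡ n
  toℚ-injective eq with refl ← cong (λ p → ∣ ↥ p ∣) eq = refl

  0<q⇒0<↥q : ∀ {q} → 0ℚ ℚ.< q → ∃ λ p → 0 < p × ↥ q ≡ + p
  0<q⇒0<↥q {q} 0<q with ℚ.positive 0<q
  0<q⇒0<↥q {mkℚ (ℤ.+[1+ n ]) _ _} _ | _ = suc n , z<s , refl

  -- Normalised division reduces by a gcd; among unnormalised rationals the product can be read off
  -- and equality is cross-multiplication.
  scaledRatio-≃ : ∀ q x y → toℚᵘ (scaledRatio q x y) ≃ toℚᵘ q ℚᵘ.* (toℤ y ℚᵘ./ ℕ⁺.value x)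
  scaledRatio-≃ q (mkℕ⁺ (suc x)) y = ℚᵘ.≃-trans (ℚ.toℚᵘ-homo-* q (toℤ y ℚ./ suc x))
    (ℚᵘ.*-congˡ {toℚᵘ q} (ℚ.toℚᵘ-fromℚᵘ (mkℚᵘ (toℤ y) x)))

  scaledRatio≡ : ∀ q {p} → ↥ q ≡ + p → ∀ x y z → 
    scaledRatio q x y ≡ toℚ z ⇔ p * ℕ⁺.value y ≡ ℕ⁺.value z * (↧ₙ q * ℕ⁺.value x)
  scaledRatio≡ q@(mkℚ (+ p) d _) refl x@(mkℕ⁺ (suc x′)) y@(mkℕ⁺ y′) z@(mkℕ⁺ z′) = mk⇔ to from
    where
    u = suc d * suc x′
    to : scaledRatio q x y ≡ toℚ z → p * y′ ≡ z′ * u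
    to eq with *≡* e ← ℚᵘ.≃-trans (ℚᵘ.≃-sym (scaledRatio-≃ q x y)) (ℚ.toℚᵘ-cong eq) =
      ℤ.+-injective (begin
        + (p * y′)               ≡⟨ ℤ.pos-* p y′ ⟩
        + p ℤ.* + y′             ≡⟨ ℤ.*-identityʳ _ ⟨
        (+ p ℤ.* + y′) ℤ.* ℤ.1ℤ  ≡⟨ e ⟩
        + z′ ℤ.* + u             ≡⟨ ℤ.pos-* z′ u ⟨
        + (z′ * u)               ∎)
      where open ≡-Reasoning
    from : p * y′ ≡ z′ * u → scaledRatio q x y ≡ toℚ z
    from eq = ℚ.toℚᵘ-injective (ℚᵘ.≃-trans (scaledRatio-≃ q x y) (*≡* (begin
        (+ p ℤ.* + y′) ℤ.* ℤ.1ℤ  ≡⟨ ℤ.*-identityʳ _ ⟩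
        + p ℤ.* + y′             ≡⟨ ℤ.pos-* p y′ ⟨
        + (p * y′)               ≡⟨ cong +_ eq ⟩
        + (z′ * u)               ≡⟨ ℤ.pos-* z′ u ⟩
        + z′ ℤ.* + u             ∎)))
      where open ≡-Reasoning

-- Sufficiency: solutions with arbitrarily large x.

module Sufficiency where
  open RationalEntries
  open DivisibleBlocks
  open import Data.Fin.Base using (Fin)
  open import Data.Integer.Base as ℤ using (+_; ∣_∣; 1ℤ)
  import Data.Integer.Properties as ℤ
  import Data.List.Base as List
  open import Data.List.Membership.Propositional using (_∈_)
  open import Data.List.Relation.Unary.Any using (here; there)
  open import Data.Nat.Base
  open import Data.Nat.ListAction using (sum)
  open import Data.Nat.Properties
  open import Data.Product.Base using (_,_; proj₁; proj₂)
  open import Data.Rational.Base as ℚ using (ℚ; 0ℚ; ↥_; ↧ₙ_)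
  open import Data.Rational.Literals using (fromℤ)
  open import Data.Vec.Base using (Vec; []; _∷_; head)
  open import Data.Vec.Relation.Unary.All using ([]; _∷_)
  open import Function.Bundles using (Equivalence)
  open import Relation.Binary.PropositionalEquality

  -- `suc (pred n)` is nonzero by its form; thus 0 receives the colour of 1.
  colourℕ : ∀ {r} → Colouring r → ℕ → Fin r
  colourℕ χ n = χ (mkℕ⁺ (suc (pred n)))

  colourℕ-value : ∀ {r} (χ : Colouring r) n → colourℕ χ (ℕ⁺.value n) ≡ χ n
  colourℕ-value χ (mkℕ⁺ (suc n)) = refl

  ∈⇒≤sum : ∀ {A : Set} (f : A → ℕ) {a as} → a ∈ as → f a ≤ sum (List.map f as)
  ∈⇒≤sum f (here refl) = m≤m+n _ _
  ∈⇒≤sum f {as = b List.∷ _} (there a∈) = ≤-trans (∈⇒≤sum f a∈) (m≤n+m _ (f b))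

  -- Given a finite list said to contain all monochromatic tuples, `K` exceeds the numerator of the
  -- first entry of each listed tuple, so a solution with x ≥ K is missing from the list.
  x+y-y/x-partitionRegular : ∀ q → 0ℚ ℚ.< q → PartitionRegular
      ( (λ x y → toℚ x)
      ∷ (λ x y → toℚ y)
      ∷ (λ x y → fromℤ (1ℤ ℤ.* toℤ x ℤ.+ 1ℤ ℤ.* toℤ y))
      ∷ (λ x y → scaledRatio q x y)
      ∷ [])
  x+y-y/x-partitionRegular q 0<q r χ (tuples , complete) =
    <⇒≱ (s≤s (∈⇒≤sum size (complete ((x , y , refl) , χ x , monochromatic)))) K≤x
    where
    size : ∀ {k} → Vec ℚ (suc k) → ℕ
    size t = ∣ ↥ head t ∣

    K = suc (sum (List.map size tuples))
    numerator = 0<q⇒0<↥q 0<q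

    open MonochromaticQuadruple
      (monochromaticQuadruple (colourℕ χ) (proj₁ (proj₂ numerator)) (z<s {↧ₙ q ∸ 1}) (z<s {pred K}))
      renaming (x to x′; y to y′; z to z′)

    x y z x+y : ℕ⁺
    x   = mkℕ⁺ x′ {{>-nonZero x>0}}
    y   = mkℕ⁺ y′ {{>-nonZero y>0}}
    z   = mkℕ⁺ z′ {{>-nonZero z>0}}
    x+y = mkℕ⁺ (x′ + y′) {{>-nonZero (≤-trans x>0 (m≤m+n x′ y′))}}

    sameColour : ∀ n → colourℕ χ (ℕ⁺.value n) ≡ colourℕ χ x′ → χ n ≡ χ x
    sameColour n eq = trans (sym (colourℕ-value χ n)) (trans eq (colourℕ-value χ x))

    monochromatic = (x , refl , refl)
      ∷ (y , refl , sameColour y χy≡χx)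
      ∷ (x+y , cong fromℤ (cong₂ ℤ._+_ (ℤ.*-identityˡ (toℤ x)) (ℤ.*-identityˡ (toℤ y))) ,
          sameColour x+y χx+y≡χx)
      ∷ (z , Equivalence.from (scaledRatio≡ q (proj₂ (proj₂ numerator)) x y z) ratio ,
          sameColour z χz≡χx)
      ∷ []

-- Monochromatic tuples as solutions in positive integers.

module Solutions where
  open RationalEntries
  open import Data.Integer.Base as ℤ using (ℤ; +_)
  open import Data.Nat.Base
  open import Data.Product.Base using (_,_)
  open import Data.Rational.Base using (ℚ; ↥_; ↧ₙ_)
  open import Data.Rational.Literals using (fromℤ)
  open import Data.Vec.Base using (Vec; []; _∷_)
  open import Data.Vec.Relation.Unary.All using ([]; _∷_)
  open import Function.Bundles using (Equivalence)
  open import Relation.Binary.PropositionalEquality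

  ratioPattern : ℚ → ℤ → ℤ → Pattern 4
  ratioPattern q c d =
      (λ x y → toℚ x)
    ∷ (λ x y → toℚ y)
    ∷ (λ x y → fromℤ (c ℤ.* toℤ x ℤ.+ d ℤ.* toℤ y))
    ∷ (λ x y → scaledRatio q x y)
    ∷ []

  record MonochromaticSolution {r} (χ : Colouring r) (q : ℚ) (p : ℕ) (c d : ℤ) (t : Vec ℚ 4) : Set where
    field
      x y w z : ℕ⁺
      entries : t ≡ toℚ x ∷ toℚ y ∷ toℚ w ∷ toℚ z ∷ []
      sum≡    : c ℤ.* toℤ x ℤ.+ d ℤ.* toℤ y ≡ toℤ w
      ratio   : p * ℕ⁺.value y ≡ ℕ⁺.value z * (↧ₙ q * ℕ⁺.value x)
      χy≡χx   : χ y ≡ χ x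
      χw≡χx   : χ w ≡ χ x
      χz≡χx   : χ z ≡ χ x

  monochromaticSolution : ∀ {r} (χ : Colouring r) q {p} c d {t} → ↥ q ≡ + p →
    MonochromaticTuples χ (ratioPattern q c d) t → MonochromaticSolution χ q p c d t
  monochromaticSolution χ q c d ↥q≡p
    ((u , v , refl) , k , (x , ux , χx) ∷ (y , vy , χy) ∷ (w , eqw , χw) ∷ (z , eqz , χz) ∷ [])
    with refl ← toℚ-injective {u} {x} ux | refl ← toℚ-injective {v} {y} vy = record
    { x = x ; y = y ; w = w ; z = z
    ; entries = cong₂ (λ a b → toℚ x ∷ toℚ y ∷ a ∷ b ∷ []) eqw eqz
    ; sum≡    = fromℤ-injective eqw
    ; ratio   = Equivalence.to (scaledRatio≡ q ↥q≡p x y z) eqz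
    ; χy≡χx   = trans χy (sym χx)
    ; χw≡χx   = trans χw (sym χx)
    ; χz≡χx   = trans χz (sym χx)
    }

-- Congruences, large primes and unit parts.

module ModularArithmetic where
  open DivisibleBlocks using (m≤n⇒m∣n!)
  open import Data.Integer.Base as ℤ using (ℤ; +_; ∣_∣)
  import Data.Integer.Properties as ℤ
  open import Data.Integer.Divisibility.Signed as ℤ using (∣ᵤ⇒∣; ∣⇒∣ᵤ)
  open import Data.Integer.Tactic.RingSolver using (solve-∀)
  open import Data.List.Base using ([]; _∷_)
  open import Data.List.Relation.Unary.All using (_∷_)
  open import Data.Nat.Base
  open import Data.Nat.Divisibility
  open import Data.Nat.DivMod
  open import Data.Nat.Induction using (<-rec)
  open import Data.Nat.Primality
  open import Data.Nat.Primality.Factorisation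
  open import Data.Nat.Properties
  open import Data.Product.Base using (∃; ∃₂; _×_; _,_)
  open import Data.Sum.Base using ([_,_]′)
  open import Relation.Binary.PropositionalEquality
  open import Relation.Nullary using (¬_; yes; no; contradiction)

  %≡%⇒∣ : ∀ m e n .{{_ : NonZero n}} → (m + e) % n ≡ m % n → n ∣ e
  %≡%⇒∣ m e n eq = ∣m+n∣m⇒∣n (divides ((m + e) / n) (+-cancelˡ-≡ (m % n) _ _ (begin
    m % n + (m / n * n + e)          ≡⟨ +-assoc (m % n) _ e ⟨
    (m % n + m / n * n) + e          ≡⟨ cong (_+ e) (m≡m%n+[m/n]*n m n) ⟨
    m + e                            ≡⟨ m≡m%n+[m/n]*n (m + e) n ⟩
    (m + e) % n + (m + e) / n * n    ≡⟨ cong (_+ (m + e) / n * n) eq ⟩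
    m % n + (m + e) / n * n          ∎))) (n∣m*n (m / n))
    where open ≡-Reasoning

  %≡%⇒∣- : ∀ m n k .{{_ : NonZero k}} → m % k ≡ n % k → + k ℤ.∣ + m ℤ.- + n
  %≡%⇒∣- m n k eq = ℤ.divides (+ (m / k) ℤ.- + (n / k)) (begin
    + m ℤ.- + n
      ≡⟨ cong₂ ℤ._-_ (expand m) (expand n) ⟩
    (+ (m % k) ℤ.+ + (m / k) ℤ.* + k) ℤ.- (+ (n % k) ℤ.+ + (n / k) ℤ.* + k)
      ≡⟨ cong (λ r → (+ r ℤ.+ + (m / k) ℤ.* + k) ℤ.- (+ (n % k) ℤ.+ + (n / k) ℤ.* + k)) eq ⟩
    (+ (n % k) ℤ.+ + (m / k) ℤ.* + k) ℤ.- (+ (n % k) ℤ.+ + (n / k) ℤ.* + k)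
      ≡⟨ difference (+ (n % k)) (+ (m / k)) (+ (n / k)) (+ k) ⟩
    (+ (m / k) ℤ.- + (n / k)) ℤ.* + k ∎)
    where
    open ≡-Reasoning
    expand : ∀ m → + m ≡ + (m % k) ℤ.+ + (m / k) ℤ.* + k
    expand m = trans (cong +_ (m≡m%n+[m/n]*n m k)) (cong (λ i → + (m % k) ℤ.+ i) (ℤ.pos-* (m / k) k))
    difference : ∀ r a b k → (r ℤ.+ a ℤ.* k) ℤ.- (r ℤ.+ b ℤ.* k) ≡ (a ℤ.- b) ℤ.* k
    difference = solve-∀

  -- Euclid's argument: a prime factor of n! + 1 cannot be at most `n`. An empty factorisation would
  -- mean n! = 0.
  largePrime : ∀ n → ∃ λ p → Prime p × n < p
  largePrime n with factorise (suc (n !))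
  ... | record { factors = [] ; isFactorisation = eq } =
    contradiction (subst (1 ≤_) (suc-injective eq) (1≤n! n)) λ ()
  ... | record { factors = p ∷ ps ; isFactorisation = eq ; factorsPrime = p-prime ∷ _ } =
    p , p-prime , ≰⇒> λ p≤n → ¬prime[1] (subst Prime (∣1⇒≡1 (∣m+n∣m⇒∣n
      (subst (p ∣_) (trans (sym eq) (+-comm 1 (n !))) (m∣m*n _))
      (m≤n⇒m∣n! (>-nonZero⁻¹ p {{prime⇒nonZero p-prime}}) p≤n))) p-prime)

  module _ {p} (p-prime : Prime p) where

    private instance
      p≢0 : NonZero p
      p≢0 = prime⇒nonZero p-prime

    p∤-* : ∀ {i j} → ¬ + p ℤ.∣ i → ¬ + p ℤ.∣ j → ¬ + p ℤ.∣ i ℤ.* j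
    p∤-* {i} {j} p∤i p∤j p∣ij =
      [ (λ p∣i → p∤i (∣ᵤ⇒∣ p∣i)) , (λ p∣j → p∤j (∣ᵤ⇒∣ p∣j)) ]′
        (euclidsLemma ∣ i ∣ ∣ j ∣ p-prime (subst (p ∣_) (ℤ.abs-* i j) (∣⇒∣ᵤ p∣ij)))

    0<n<p⇒p∤ : ∀ {i} → i ≢ + 0 → ∣ i ∣ < p → ¬ + p ℤ.∣ i
    0<n<p⇒p∤ {i} i≢0 ∣i∣<p p∣i = >⇒∤ {{ℤ.≢-nonZero i≢0}} ∣i∣<p (∣⇒∣ᵤ p∣i)

    -- Common powers of `p` cancel; if the exponents differ, `p` ends up dividing `i` or `j`. The
    -- cofactors are integers because the one involving c may be negative.
    unitPart-unique : ∀ a b {i j} → (+ p) ℤ.^ a ℤ.* i ≡ (+ p) ℤ.^ b ℤ.* j →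
      ¬ + p ℤ.∣ i → ¬ + p ℤ.∣ j → i ≡ j
    unitPart-unique zero    zero    {i} {j} eq _ _ =
      trans (sym (ℤ.*-identityˡ i)) (trans eq (ℤ.*-identityˡ j))
    unitPart-unique zero    (suc b) {i} {j} eq p∤i _ = contradiction
      (ℤ.∣-trans (ℤ.∣m⇒∣m*n j (ℤ.∣m⇒∣m*n ((+ p) ℤ.^ b) ℤ.∣-refl))
         (ℤ.∣-reflexive (trans (sym eq) (ℤ.*-identityˡ i)))) p∤i
    unitPart-unique (suc a) zero    {i} {j} eq _ p∤j = contradiction
      (ℤ.∣-trans (ℤ.∣m⇒∣m*n i (ℤ.∣m⇒∣m*n ((+ p) ℤ.^ a) ℤ.∣-refl))
         (ℤ.∣-reflexive (trans eq (ℤ.*-identityˡ j)))) p∤j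
    unitPart-unique (suc a) (suc b) {i} {j} eq p∤i p∤j = unitPart-unique a b
      (ℤ.*-cancelˡ-≡ (+ p) _ _ (trans (sym (ℤ.*-assoc (+ p) _ i)) (trans eq (ℤ.*-assoc (+ p) _ j))))
      p∤i p∤j

    -- Here `a` is the p-adic valuation of `n`, and the residue of `u` modulo `p` is the last
    -- nonzero digit of `n` in base `p`.
    Decomposition : ℕ → Set
    Decomposition n = ∃₂ λ a u → + n ≡ (+ p) ℤ.^ a ℤ.* + u × ¬ + p ℤ.∣ + u

    decompose : ∀ n → .{{NonZero n}} → Decomposition n
    decompose n = <-rec (λ n → .{{NonZero n}} → Decomposition n) step n
      where
      step : ∀ n → (∀ {k} → k < n → .{{NonZero k}} → Decomposition k) → .{{NonZero n}} → Decomposition n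
      step n rec with p ∣? n
      ... | no p∤n = 0 , n , sym (ℤ.*-identityˡ (+ n)) , λ p∣n → p∤n (∣⇒∣ᵤ p∣n)
      ... | yes (divides-refl (suc k))
        with a , u , eq , p∤u ← rec (m<m*n (suc k) p (nonTrivial⇒n>1 p {{prime⇒nonTrivial p-prime}})) =
        suc a , u , (begin
          + (suc k * p)                    ≡⟨ ℤ.pos-* (suc k) p ⟩
          + suc k ℤ.* + p                  ≡⟨ cong (ℤ._* + p) eq ⟩
          (+ p) ℤ.^ a ℤ.* + u ℤ.* + p      ≡⟨ rotate ((+ p) ℤ.^ a) (+ u) (+ p) ⟩
          + p ℤ.* (+ p) ℤ.^ a ℤ.* + u      ∎) , p∤u
        where
        open ≡-Reasoning
        rotate : ∀ x y z → x ℤ.* y ℤ.* z ≡ z ℤ.* x ℤ.* y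
        rotate = solve-∀

-- Necessity of c = 1 when d = 1: colouring by p-adic digits.

module LastDigit where
  open ModularArithmetic
  open Solutions
  open import Data.Empty using (⊥-elim)
  open import Data.Fin.Base using (toℕ; combine)
  open import Data.Fin.Properties using (toℕ-fromℕ<; combine-injective)
  open import Data.Integer.Base as ℤ using (ℤ; +_; 0ℤ; 1ℤ; ∣_∣)
  import Data.Integer.Properties as ℤ
  open import Data.Integer.Divisibility.Signed as ℤ using (∣ᵤ⇒∣; ∣⇒∣ᵤ)
  open import Data.Integer.Tactic.RingSolver using (solve-∀)
  open import Data.List.Base using ([])
  open import Data.Nat.Base
  open import Data.Nat.Divisibility using (_∣?_)
  open import Data.Nat.DivMod using (_%_; _mod_; m%n<n)
  open import Data.Nat.Primality using (Prime; prime⇒nonZero)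
  open import Data.Nat.Properties
  open import Data.Product.Base using (_×_; _,_; proj₁; proj₂)
  open import Data.Rational.Base using (↥_; ↧ₙ_)
  open import Relation.Binary.PropositionalEquality
  open import Relation.Nullary using (¬_; yes; no; contradiction)

  mod≡⇒%≡ : ∀ m n k .{{_ : NonZero k}} → m mod k ≡ n mod k → m % k ≡ n % k
  mod≡⇒%≡ m n k eq =
    trans (sym (toℕ-fromℕ< (m%n<n m k))) (trans (cong toℕ eq) (toℕ-fromℕ< (m%n<n n k)))

  module _ {p} (p-prime : Prime p) where

    private instance
      p≢0 : NonZero p
      p≢0 = prime⇒nonZero p-prime

    decompose⁺ : ∀ n → Decomposition p-prime (ℕ⁺.value n)
    decompose⁺ (mkℕ⁺ n) = decompose p-prime n

    unitPart : ℕ⁺ → ℕ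
    unitPart n = proj₁ (proj₂ (decompose⁺ n))

    digitColouring : Colouring (p * p)
    digitColouring n = combine (ℕ⁺.value n mod p) (unitPart n mod p)

    digitColouring-≡ : ∀ m n → digitColouring m ≡ digitColouring n →
      + p ℤ.∣ toℤ m ℤ.- toℤ n × + p ℤ.∣ + unitPart m ℤ.- + unitPart n
    digitColouring-≡ m n eq with e₁ , e₂ ← combine-injective {p} {p} _ _ _ _ eq =
      %≡%⇒∣- (ℕ⁺.value m) (ℕ⁺.value n) p (mod≡⇒%≡ (ℕ⁺.value m) (ℕ⁺.value n) p e₁) ,
      %≡%⇒∣- (unitPart m) (unitPart n) p (mod≡⇒%≡ (unitPart m) (unitPart n) p e₂)

    noSolution : ∀ {q P c t} → ¬ + p ℤ.∣ + P → ¬ + p ℤ.∣ c → ¬ + p ℤ.∣ c ℤ.- 1ℤ →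
      ¬ MonochromaticSolution digitColouring q P c 1ℤ t
    noSolution {q} {P} {c} p∤P p∤c p∤c-1 S with p ∣? ℕ⁺.value z
      where open MonochromaticSolution S
    -- Here x ≡ z is prime to `p`, while w ≡ x ≡ y makes `p` divide w - y = c x.
    ... | no p∤z = p∤-* p-prime p∤c p∤x (subst (+ p ℤ.∣_) w-y≡cx
        (subst (+ p ℤ.∣_) (telescope (toℤ w) (toℤ x) (toℤ y))
          (ℤ.∣m∣n⇒∣m-n (proj₁ (digitColouring-≡ w x χw≡χx)) (proj₁ (digitColouring-≡ y x χy≡χx)))))
      where
      open MonochromaticSolution S
      telescope : ∀ w x y → (w ℤ.- x) ℤ.- (y ℤ.- x) ≡ w ℤ.- y
      telescope = solve-∀
      cancel : ∀ c x y → c ℤ.* x ℤ.+ 1ℤ ℤ.* y ℤ.- y ≡ c ℤ.* x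
      cancel = solve-∀
      w-y≡cx : toℤ w ℤ.- toℤ y ≡ c ℤ.* toℤ x
      w-y≡cx = trans (cong (ℤ._- toℤ y) (sym sum≡)) (cancel c (toℤ x) (toℤ y))
      add : ∀ z x → (z ℤ.- x) ℤ.+ x ≡ z
      add = solve-∀
      p∤x : ¬ + p ℤ.∣ toℤ x
      p∤x p∣x = p∤z (∣⇒∣ᵤ (subst (+ p ℤ.∣_) (add (toℤ z) (toℤ x))
        (ℤ.∣m∣n⇒∣m+n (proj₁ (digitColouring-≡ z x χz≡χx)) p∣x)))
    -- Since uw ≡ ux and p ∣ z, the relation `units≡` becomes P ux c ≡ P ux modulo `p`, although `p`
    -- divides none of P, ux and c - 1.
    ... | yes p∣z = p∤-* p-prime (p∤-* p-prime p∤P p∤ux) p∤c-1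
        (subst (+ p ℤ.∣_) Pu[c-1]≡
          (ℤ.∣m∣n⇒∣m-n (ℤ.∣n⇒∣m*n (+ P) (proj₂ (digitColouring-≡ w x χw≡χx)))
                        (ℤ.∣n⇒∣m*n ux p∣zD)))
      where
      open MonochromaticSolution S
      D ux uw pᵃ pᵇ : ℤ
      D  = + ↧ₙ q
      ux = + unitPart x
      uw = + unitPart w

      dx = decompose⁺ x
      dw = decompose⁺ w
      pᵃ = (+ p) ℤ.^ proj₁ dx
      pᵇ = (+ p) ℤ.^ proj₁ dw

      x≡ : toℤ x ≡ pᵃ ℤ.* ux
      x≡ = proj₁ (proj₂ (proj₂ dx))
      w≡ : toℤ w ≡ pᵇ ℤ.* uw
      w≡ = proj₁ (proj₂ (proj₂ dw))
      p∤ux : ¬ + p ℤ.∣ ux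
      p∤ux = proj₂ (proj₂ (proj₂ dx))
      p∤uw : ¬ + p ℤ.∣ uw
      p∤uw = proj₂ (proj₂ (proj₂ dw))

      p∣zD : + p ℤ.∣ toℤ z ℤ.* D
      p∣zD = ℤ.∣m⇒∣m*n D (∣ᵤ⇒∣ {i = toℤ z} p∣z)

      p∤Pc+zD : ¬ + p ℤ.∣ + P ℤ.* c ℤ.+ toℤ z ℤ.* D
      p∤Pc+zD p∣ = p∤-* p-prime p∤P p∤c (ℤ.∣m+n∣n⇒∣m p∣ p∣zD)

      ratioℤ : + P ℤ.* toℤ y ≡ toℤ z ℤ.* (D ℤ.* toℤ x)
      ratioℤ = begin
        + P ℤ.* toℤ y                         ≡⟨ ℤ.pos-* P _ ⟨
        + (P * ℕ⁺.value y)                     ≡⟨ cong +_ ratio ⟩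
        + (ℕ⁺.value z * (↧ₙ q * ℕ⁺.value x))   ≡⟨ ℤ.pos-* (ℕ⁺.value z) _ ⟩
        toℤ z ℤ.* + (↧ₙ q * ℕ⁺.value x)       ≡⟨ cong (toℤ z ℤ.*_) (ℤ.pos-* (↧ₙ q) _) ⟩
        toℤ z ℤ.* (D ℤ.* toℤ x)               ∎
        where open ≡-Reasoning

      -- Multiplying w = c x + y by P and inserting P y = z D x gives P w = x (P c + z D). The last
      -- factor is prime to `p` because p ∣ z, so the unit parts of both sides can be compared.
      units≡ : ux ℤ.* (+ P ℤ.* c ℤ.+ toℤ z ℤ.* D) ≡ + P ℤ.* uw
      units≡ = unitPart-unique p-prime (proj₁ dx) (proj₁ dw) (begin
        pᵃ ℤ.* (ux ℤ.* (+ P ℤ.* c ℤ.+ toℤ z ℤ.* D))       ≡⟨ ℤ.*-assoc pᵃ ux _ ⟨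
        pᵃ ℤ.* ux ℤ.* (+ P ℤ.* c ℤ.+ toℤ z ℤ.* D)         ≡⟨ cong (ℤ._* (+ P ℤ.* c ℤ.+ toℤ z ℤ.* D)) x≡ ⟨
        toℤ x ℤ.* (+ P ℤ.* c ℤ.+ toℤ z ℤ.* D)             ≡⟨ expand (toℤ x) (+ P) c (toℤ z) D ⟩
        + P ℤ.* (c ℤ.* toℤ x) ℤ.+ toℤ z ℤ.* (D ℤ.* toℤ x) ≡⟨ cong (ℤ._+_ (+ P ℤ.* (c ℤ.* toℤ x))) ratioℤ ⟨
        + P ℤ.* (c ℤ.* toℤ x) ℤ.+ + P ℤ.* toℤ y           ≡⟨ factor (+ P) (c ℤ.* toℤ x) (toℤ y) ⟩
        + P ℤ.* (c ℤ.* toℤ x ℤ.+ 1ℤ ℤ.* toℤ y)            ≡⟨ cong (+ P ℤ.*_) (trans sum≡ w≡) ⟩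
        + P ℤ.* (pᵇ ℤ.* uw)                               ≡⟨ swap (+ P) pᵇ uw ⟩
        pᵇ ℤ.* (+ P ℤ.* uw)                               ∎)
        (p∤-* p-prime p∤ux p∤Pc+zD) (p∤-* p-prime p∤P p∤uw)
        where
        open ≡-Reasoning
        expand : ∀ x p c z d →
          x ℤ.* (p ℤ.* c ℤ.+ z ℤ.* d) ≡ p ℤ.* (c ℤ.* x) ℤ.+ z ℤ.* (d ℤ.* x)
        expand = solve-∀
        factor : ∀ p a y → p ℤ.* a ℤ.+ p ℤ.* y ≡ p ℤ.* (a ℤ.+ 1ℤ ℤ.* y)
        factor = solve-∀
        swap : ∀ p a b → p ℤ.* (a ℤ.* b) ≡ a ℤ.* (p ℤ.* b)
        swap = solve-∀

      Pu[c-1]≡ : + P ℤ.* (uw ℤ.- ux) ℤ.- ux ℤ.* (toℤ z ℤ.* D) ≡ + P ℤ.* ux ℤ.* (c ℤ.- 1ℤ)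
      Pu[c-1]≡ = begin
        + P ℤ.* (uw ℤ.- ux) ℤ.- ux ℤ.* (toℤ z ℤ.* D)
          ≡⟨ left (+ P) uw ux (toℤ z) D ⟩
        + P ℤ.* uw ℤ.- (+ P ℤ.* ux ℤ.+ ux ℤ.* (toℤ z ℤ.* D))
          ≡⟨ cong (ℤ._- (+ P ℤ.* ux ℤ.+ ux ℤ.* (toℤ z ℤ.* D))) units≡ ⟨
        ux ℤ.* (+ P ℤ.* c ℤ.+ toℤ z ℤ.* D) ℤ.- (+ P ℤ.* ux ℤ.+ ux ℤ.* (toℤ z ℤ.* D))
          ≡⟨ right (+ P) ux c (toℤ z) D ⟩
        + P ℤ.* ux ℤ.* (c ℤ.- 1ℤ) ∎
        where
        open ≡-Reasoning
        left : ∀ p w x z d →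
          p ℤ.* (w ℤ.- x) ℤ.- x ℤ.* (z ℤ.* d) ≡ p ℤ.* w ℤ.- (p ℤ.* x ℤ.+ x ℤ.* (z ℤ.* d))
        left = solve-∀
        right : ∀ p x c z d →
          x ℤ.* (p ℤ.* c ℤ.+ z ℤ.* d) ℤ.- (p ℤ.* x ℤ.+ x ℤ.* (z ℤ.* d)) ≡ p ℤ.* x ℤ.* (c ℤ.- 1ℤ)
        right = solve-∀

  -- If c ≠ 1, a prime above P + |c| + |c - 1| divides none of these three nonzero numbers, so the
  -- digit colouring has no monochromatic tuple at all and the empty list is complete.
  d≡1⇒c≡1 : ∀ {q P c} → ↥ q ≡ + P → 0 < P → c ≢ 0ℤ → PartitionRegular (ratioPattern q c 1ℤ) → c ≡ 1ℤ
  d≡1⇒c≡1 {q} {P} {c} ↥q≡P 0<P c≢0 regular with c ℤ.≟ 1ℤ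
  ... | yes c≡1 = c≡1
  ... | no  c≢1 with p , p-prime , large ← largePrime (P + (∣ c ∣ + ∣ c ℤ.- 1ℤ ∣)) =
    ⊥-elim (regular (p * p) (digitColouring p-prime) ([] , λ m →
      contradiction (monochromaticSolution (digitColouring p-prime) q c 1ℤ ↥q≡P m) (noSolution p-prime
        (0<n<p⇒p∤ p-prime (λ eq → <⇒≢ 0<P (sym (ℤ.+-injective eq))) (≤-<-trans (m≤m+n P _) large))
        (0<n<p⇒p∤ p-prime c≢0 (≤-<-trans (≤-trans (m≤m+n ∣ c ∣ _) (m≤n+m _ P)) large))
        (0<n<p⇒p∤ p-prime (λ eq → c≢1 (ℤ.i-j≡0⇒i≡j c 1ℤ eq))
          (≤-<-trans (≤-trans (m≤n+m _ ∣ c ∣) (m≤n+m _ P)) large)))))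

-- Necessity of d = 1: colouring by logarithms.

module Growth where
  open ModularArithmetic using (%≡%⇒∣)
  open LastDigit using (mod≡⇒%≡)
  open Solutions
  open import Data.Empty using (⊥; ⊥-elim)
  open import Data.Fin.Base using (combine; fromℕ<)
  open import Data.Fin.Properties using (fromℕ<-injective; combine-injective)
  open import Data.Integer.Base as ℤ using (ℤ; +_; -[1+_]; 0ℤ; 1ℤ; ∣_∣)
  import Data.Integer.Properties as ℤ
  import Data.Integer.Tactic.RingSolver as ℤ
  open import Data.List.Base as List using (upTo)
  open import Data.List.Membership.Propositional using (_∈_)
  open import Data.List.Membership.Propositional.Properties using (∈-map⁺; ∈-upTo⁺)
  open import Data.Nat.Base
  open import Data.Nat.Divisibility using (_∣_; >⇒∤)
  open import Data.Nat.DivMod using (_%_; _mod_)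
  open import Data.Nat.Logarithm using (⌊log₂_⌋; ⌊log₂⌋-mono-≤; ⌊log₂[2*b]⌋≡1+⌊log₂b⌋)
  open import Data.Nat.Properties
  open import Data.Nat.Tactic.RingSolver using (solve-∀)
  open import Data.Product.Base using (_×_; _,_; proj₁; proj₂)
  open import Data.Rational.Base using (ℚ; ↥_; ↧ₙ_)
  open import Data.Rational.Literals using (fromℤ)
  open import Data.Sum.Base using (inj₁; inj₂)
  open import Data.Vec.Base using (Vec; []; _∷_)
  open import Relation.Binary.PropositionalEquality
  open import Relation.Nullary using (yes; no; contradiction)

  n≤2^n : ∀ n → n ≤ 2 ^ n
  n≤2^n zero    = z≤n
  n≤2^n (suc n) = ≤-trans (+-mono-≤ (m^n>0 2 n) (n≤2^n n))
    (≤-reflexive (cong (_+_ (2 ^ n)) (sym (+-identityʳ (2 ^ n)))))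

  ⌊log₂[2^k*n]⌋ : ∀ k n .{{_ : NonZero n}} → ⌊log₂ (2 ^ k * n) ⌋ ≡ k + ⌊log₂ n ⌋
  ⌊log₂[2^k*n]⌋ zero    n = cong ⌊log₂_⌋ (*-identityˡ n)
  ⌊log₂[2^k*n]⌋ (suc k) n = trans (cong ⌊log₂_⌋ (*-assoc 2 (2 ^ k) n))
    (trans (⌊log₂[2*b]⌋≡1+⌊log₂b⌋ (2 ^ k * n) {{m*n≢0 (2 ^ k) n {{m^n≢0 2 k}}}})
      (cong suc (⌊log₂[2^k*n]⌋ k n)))

  -- Squaring turns a ratio of at least 3/2 into one of at least 2.
  logSquare : ℕ → ℕ
  logSquare n = ⌊log₂ (n * n) ⌋

  -- From 2 y² ≤ w² ≤ e² y² ≤ 2^(e²) y² the two values of `logSquare` differ by at least 1 and at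
  -- most e², hence not by a multiple of e² + 1.
  logSquare-separates : ∀ {y w e} .{{_ : NonZero y}} → 3 * y ≤ 2 * w → w ≤ e * y →
    logSquare w % suc (e * e) ≢ logSquare y % suc (e * e)
  logSquare-separates {y} {w} {e} 3y≤2w w≤ey eq =
    contradiction (%≡%⇒∣ (logSquare y) δ (suc (e * e)) (trans (cong (_% suc (e * e)) (m+[n∸m]≡n (<⇒≤ lower))) eq))
      (>⇒∤ {{>-nonZero (m<n⇒0<n∸m lower)}} (s≤s (m≤n+o⇒m∸n≤o (logSquare w) (logSquare y) upper)))
    where
    δ = logSquare w ∸ logSquare y
    instance
      yy≢0 : NonZero (y * y)
      yy≢0 = m*n≢0 y y

    2yy≤ww : 2 * (y * y) ≤ w * w
    2yy≤ww = *-cancelˡ-≤ 4 (begin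
      4 * (2 * (y * y))          ≤⟨ m≤m+n _ (y * y) ⟩
      4 * (2 * (y * y)) + y * y  ≡⟨ nine y ⟩
      (3 * y) * (3 * y)          ≤⟨ *-mono-≤ 3y≤2w 3y≤2w ⟩
      (2 * w) * (2 * w)          ≡⟨ four w ⟩
      4 * (w * w)                ∎)
      where
      open ≤-Reasoning
      nine : ∀ y → 4 * (2 * (y * y)) + y * y ≡ (3 * y) * (3 * y)
      nine = solve-∀
      four : ∀ w → (2 * w) * (2 * w) ≡ 4 * (w * w)
      four = solve-∀

    lower : logSquare y < logSquare w
    lower = ≤-trans (≤-reflexive (sym (⌊log₂[2*b]⌋≡1+⌊log₂b⌋ (y * y)))) (⌊log₂⌋-mono-≤ 2yy≤ww)

    upper : logSquare w ≤ logSquare y + e * e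
    upper = begin
      ⌊log₂ (w * w) ⌋                  ≤⟨ ⌊log₂⌋-mono-≤ (*-mono-≤ w≤ey w≤ey) ⟩
      ⌊log₂ ((e * y) * (e * y)) ⌋      ≡⟨ cong ⌊log₂_⌋ (square e y) ⟩
      ⌊log₂ ((e * e) * (y * y)) ⌋      ≤⟨ ⌊log₂⌋-mono-≤ (*-monoˡ-≤ (y * y) (n≤2^n (e * e))) ⟩
      ⌊log₂ (2 ^ (e * e) * (y * y)) ⌋  ≡⟨ ⌊log₂[2^k*n]⌋ (e * e) (y * y) ⟩
      e * e + logSquare y              ≡⟨ +-comm (e * e) _ ⟩
      logSquare y + e * e              ∎
      where
      open ≤-Reasoning
      square : ∀ e y → (e * y) * (e * y) ≡ (e * e) * (y * y)
      square = solve-∀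

  -- Numbers below L have a class of their own.
  logColouring : (L M : ℕ) → Colouring (suc L * suc M)
  logColouring L M n =
    combine (fromℕ< (s≤s (m⊓n≤n (ℕ⁺.value n) L))) (logSquare (ℕ⁺.value n) mod suc M)

  logColouring-≡ : ∀ L M m n → logColouring L M m ≡ logColouring L M n →
    ℕ⁺.value m ⊓ L ≡ ℕ⁺.value n ⊓ L ×
    logSquare (ℕ⁺.value m) % suc M ≡ logSquare (ℕ⁺.value n) % suc M
  logColouring-≡ L M m n eq with e₁ , e₂ ← combine-injective {suc L} {suc M} _ _ _ _ eq =
    fromℕ<-injective _ _ _ _ e₁ , mod≡⇒%≡ (logSquare (ℕ⁺.value m)) (logSquare (ℕ⁺.value n)) (suc M) e₂

  m⊓l≡n⊓l⇒m≡n : ∀ {m n l} → n < l → m ⊓ l ≡ n ⊓ l → m ≡ n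
  m⊓l≡n⊓l⇒m≡n {m} {n} {l} n<l eq with ≤-total m l
  ... | inj₁ m≤l = trans (sym (m≤n⇒m⊓n≡m m≤l)) (trans eq (m≤n⇒m⊓n≡m (<⇒≤ n<l)))
  ... | inj₂ l≤m = contradiction
    (trans (sym (m≤n⇒m⊓n≡m (<⇒≤ n<l))) (trans (sym eq) (m≥n⇒m⊓n≡n l≤m))) (<⇒≢ n<l)

  i+j≡w⇒bounds : ∀ {i j w} → i ℤ.+ j ≡ + w → ∣ j ∣ ≤ w + ∣ i ∣ × w ≤ ∣ i ∣ + ∣ j ∣
  i+j≡w⇒bounds {i} {j} {w} eq =
    ≤-trans (≤-reflexive (cong ∣_∣ (trans (cancel i j) (cong (ℤ._- i) eq)))) (ℤ.∣i-j∣≤∣i∣+∣j∣ (+ w) i) ,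
    ≤-trans (≤-reflexive (cong ∣_∣ (sym eq))) (ℤ.∣i+j∣≤∣i∣+∣j∣ i j)
    where
    cancel : ∀ i j → j ≡ i ℤ.+ j ℤ.- i
    cancel = ℤ.solve-∀

  -- For d ≥ 2 one has w ≥ 2 y - |c| x, and 4 |c| x ≤ y leaves at least 3 y / 2. A negative d is
  -- impossible: it would give |c| x = w + |d| y ≥ y ≥ 4 |c| x with |c| x positive.
  dominatedSum : ∀ {c d x y w} .{{_ : NonZero y}} → 4 * (∣ c ∣ * x) ≤ y → d ≢ 0ℤ → d ≢ 1ℤ →
    c ℤ.* + x ℤ.+ d ℤ.* + y ≡ + w → 3 * y ≤ 2 * w × w ≤ suc ∣ d ∣ * y
  dominatedSum {d = + 0} _ d≢0 _ _ = contradiction refl d≢0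
  dominatedSum {d = + 1} _ _ d≢1 _ = contradiction refl d≢1
  dominatedSum {c} {d@(+ suc (suc e))} {x} {y} {w} 4cx≤y _ _ eq = lower , upper
    where
    A = ∣ c ∣ * x
    B = ∣ d ∣ * y
    bounds : B ≤ w + A × w ≤ A + B
    bounds = subst₂ (λ a b → b ≤ w + a × w ≤ a + b) (ℤ.abs-* c (+ x)) (ℤ.abs-* d (+ y))
      (i+j≡w⇒bounds {c ℤ.* + x} {d ℤ.* + y} eq)
    open ≤-Reasoning
    upper : w ≤ suc ∣ d ∣ * y
    upper = ≤-trans (proj₂ bounds) (+-monoˡ-≤ B (≤-trans (m≤n*m A 4) 4cx≤y))
    lower : 3 * y ≤ 2 * w
    lower = *-cancelˡ-≤ 2 (+-cancelʳ-≤ (2 * y) _ _ (begin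
      2 * (3 * y) + 2 * y    ≡⟨ eight y ⟩
      4 * (2 * y)            ≤⟨ *-monoʳ-≤ 4 (*-monoˡ-≤ y (s≤s (s≤s (z≤n {e})))) ⟩
      4 * B                  ≤⟨ *-monoʳ-≤ 4 (proj₁ bounds) ⟩
      4 * (w + A)            ≡⟨ *-distribˡ-+ 4 w A ⟩
      4 * w + 4 * A          ≤⟨ +-monoʳ-≤ (4 * w) (≤-trans 4cx≤y (m≤n*m y 2)) ⟩
      4 * w + 2 * y          ≡⟨ cong (_+ 2 * y) (*-assoc 2 2 w) ⟩
      2 * (2 * w) + 2 * y    ∎))
      where
      eight : ∀ y → 2 * (3 * y) + 2 * y ≡ 4 * (2 * y)
      eight = solve-∀
  dominatedSum {c} {d@(-[1+ e ])} {x} {y} {w} 4cx≤y _ _ eq =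
    contradiction (begin-strict
      A              <⟨ m<m*n A 4 {{>-nonZero A>0}} (s≤s z<s) ⟩
      A * 4          ≡⟨ *-comm A 4 ⟩
      4 * A          ≤⟨ 4cx≤y ⟩
      y              ≤⟨ m≤m+n y (e * y) ⟩
      suc e * y      ≤⟨ m≤n+m (suc e * y) w ⟩
      w + suc e * y  ≡⟨ A≡ ⟨
      A              ∎) (<-irrefl refl)
    where
    A = ∣ c ∣ * x
    open ≤-Reasoning
    A≡ : A ≡ w + suc e * y
    A≡ = trans (sym (ℤ.abs-* c (+ x))) (cong ∣_∣ (trans (cancel (c ℤ.* + x) (d ℤ.* + y))
      (cong₂ ℤ._+_ eq (trans (ℤ.neg-distribˡ-* d (+ y)) (sym (ℤ.pos-* (suc e) y))))))
      where
      cancel : ∀ i j → i ≡ i ℤ.+ j ℤ.+ ℤ.- j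
      cancel = ℤ.solve-∀
    A>0 : 0 < A
    A>0 = subst (0 <_) (sym A≡) (≤-trans (>-nonZero⁻¹ y) (≤-trans (m≤m+n y (e * y)) (m≤n+m _ w)))

  value≢0 : ∀ n → NonZero (ℕ⁺.value n)
  value≢0 (mkℕ⁺ (suc n)) = _

  constant : ℕ → Vec ℚ 4
  constant n = a ∷ a ∷ a ∷ a ∷ []
    where a = fromℤ (+ n)

  -- If x < L, the colour determines the value, so the tuple is constant and lies in an explicit
  -- finite list. If x ≥ L, then z ≥ L, so y dominates x and `logSquare-separates` contradicts that
  -- y and w share a colour.
  d≡1 : ∀ {q P c d} → ↥ q ≡ + P → 0 < P → d ≢ 0ℤ → PartitionRegular (ratioPattern q c d) → d ≡ 1ℤ
  d≡1 {q} {P} {c} {d} ↥q≡P 0<P d≢0 regular with d ℤ.≟ 1ℤ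
  ... | yes d≡1 = d≡1
  ... | no  d≢1 = ⊥-elim (regular _ χ (List.map constant (upTo L) ,
      λ m → exceptional (monochromaticSolution χ q c d ↥q≡P m)))
    where
    -- With D the denominator of `q` and z ≥ L, the relation P y = z D x gives P y ≥ L x = 4 |c| P
    -- x, hence y ≥ 4 |c| x.
    L = 4 * (∣ c ∣ * P)
    -- The bound w ≤ e y has e = |d| + 1, and `logColouring` reduces modulo `suc M`, that is e² + 1.
    M = suc ∣ d ∣ * suc ∣ d ∣
    χ = logColouring L M

    module _ {t} (S : MonochromaticSolution χ q P c d t) where
      open MonochromaticSolution S
      X Y W Z : ℕ
      X = ℕ⁺.value x
      Y = ℕ⁺.value y
      W = ℕ⁺.value w
      Z = ℕ⁺.value z

      small : X < L → t ≡ constant X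
      small X<L = trans entries (cong₃ (sameValue y χy≡χx) (sameValue w χw≡χx) (sameValue z χz≡χx))
        where
        sameValue : ∀ n → χ n ≡ χ x → ℕ⁺.value n ≡ X
        sameValue n eq = m⊓l≡n⊓l⇒m≡n X<L (proj₁ (logColouring-≡ L M n x eq))
        cong₃ : ∀ {a b c} → a ≡ X → b ≡ X → c ≡ X →
          toℚ x ∷ fromℤ (+ a) ∷ fromℤ (+ b) ∷ fromℤ (+ c) ∷ [] ≡ constant X
        cong₃ refl refl refl = refl

      large : X ≮ L → ⊥
      large X≮L = logSquare-separates {Y} {W} {suc ∣ d ∣} {{value≢0 y}} (proj₁ dominated) (proj₂ dominated)
        (trans (proj₂ (logColouring-≡ L M w x χw≡χx)) (sym (proj₂ (logColouring-≡ L M y x χy≡χx))))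
        where
        L≤Z : L ≤ Z
        L≤Z = m⊓n≡n⇒n≤m (trans (proj₁ (logColouring-≡ L M z x χz≡χx)) (m≥n⇒m⊓n≡n (≮⇒≥ X≮L)))
        4cX≤Y : 4 * (∣ c ∣ * X) ≤ Y
        4cX≤Y = *-cancelˡ-≤ P {{>-nonZero 0<P}} (begin
          P * (4 * (∣ c ∣ * X))  ≡⟨ rearrange P ∣ c ∣ X ⟩
          L * X                  ≤⟨ *-mono-≤ L≤Z (m≤n*m X (↧ₙ q)) ⟩
          Z * (↧ₙ q * X)         ≡⟨ ratio ⟨
          P * Y                  ∎)
          where
          open ≤-Reasoning
          rearrange : ∀ p c x → p * (4 * (c * x)) ≡ 4 * (c * p) * x
          rearrange = solve-∀
        dominated : 3 * Y ≤ 2 * W × W ≤ suc ∣ d ∣ * Y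
        dominated = dominatedSum {c} {{value≢0 y}} 4cX≤Y d≢0 d≢1 sum≡

      exceptional : t ∈ List.map constant (upTo L)
      exceptional with X <? L
      ... | yes X<L = subst (_∈ List.map constant (upTo L)) (sym (small X<L)) (∈-map⁺ constant (∈-upTo⁺ X<L))
      ... | no  X≮L = ⊥-elim (large X≮L)

open import Data.Integer.Base using (ℤ; 0ℤ; 1ℤ; _+_; _*_)
open import Data.Product.Base using (_×_; _,_)
open import Data.Rational.Base using (ℚ; 0ℚ; _<_)
open import Data.Rational.Literals using (fromℤ)
open import Data.Vec.Base using ([]; _∷_)
open import Function.Bundles using (_⇔_; mk⇔)
open import Relation.Binary.PropositionalEquality.Core using (_≡_; _≢_; refl)

theorem1p7 : ∀ (q : ℚ) (c d : ℤ) → 0ℚ < q → c ≢ 0ℤ → d ≢ 0ℤ →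
    PartitionRegular
    ( (λ x y → toℚ x)
    ∷ (λ x y → toℚ y)
    ∷ (λ x y → fromℤ (c * toℤ x + d * toℤ y))
    ∷ (λ x y → scaledRatio q x y)
    ∷ [])
    ⇔ (c ≡ 1ℤ × d ≡ 1ℤ)
theorem1p7 q c d 0<q c≢0 d≢0 = mk⇔ necessary λ where
    (refl , refl) → Sufficiency.x+y-y/x-partitionRegular q 0<q
  where
  necessary : PartitionRegular (Solutions.ratioPattern q c d) → c ≡ 1ℤ × d ≡ 1ℤ
  necessary regular
    with P , 0<P , ↥q≡P ← RationalEntries.0<q⇒0<↥q 0<q
    -- d = 1 comes first, as the digit argument for c = 1 assumes it.
    with refl ← Growth.d≡1 {q} {P} {c} {d} ↥q≡P 0<P d≢0 regular =
    LastDigit.d≡1⇒c≡1 {q} {P} {c} ↥q≡P 0<P c≢0 regular , refl
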